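{- Let $T$ be a theory (a set of sentences of the language of arithmetic). If $T$ is a consistent extension of Robinson arithmetic $Q$, then $T$ is undecidable, i.e. the set of Gödel numbers of sentences provable in $T$ is not recursive.
   Context: Fix a standard first-order language of arithmetic (with equality, constant $0$, unary function symbol $s$, binary function symbols $+,\cdot$, order $\le$ primitive or defined) and a standard Gödel numbering. A theory is an arbitrary set of sentences of this language. $Q$ is Robinson arithmetic, with axioms $s(x)\neq 0$; $s(x)=s(y)\to x=y$; $x\ne0\to\exists y\,(x=s(y))$; $x+0=x$; $x+s(y)=s(x+y)$; $x\cdot 0=0$; $x\cdot s(y)=x\cdot y+x$; $x\le y\leftrightarrow\exists z\,(z+x=y)$. An extension of $Q$ is a theory (in the same language) proving all axioms of $Q$. -}

module Defs where

open import Data.Fin.Base using (Fin; zero; suc; toℕ)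
open import Data.List.Base using (List; []; _∷_; map)
open import Data.List.Membership.Propositional using () renaming (_∈_ to _∈ˡ_)
open import Data.Nat.Base using (ℕ; zero; suc; _+_; _*_; _<_)
open import Data.Product.Base using (∃-syntax; _×_)
open import Data.Vec.Base using (Vec; []; _∷_; lookup)
open import Data.Vec.Relation.Binary.Pointwise.Inductive using (Pointwise)
open import Level using (Level; 0ℓ)
open import Relation.Binary.PropositionalEquality using (_≡_)
open import Relation.Nullary.Negation.Core using (¬_)
open import Relation.Unary using (Pred; _∈_; _∉_)

infix  13 `_
infixl 12 _⊗_
infixl 11 _⊕_
infix  10 _≐_ _≦_
infix  9  ¬̇_ ∀̇_ ∃̇_
infixr 8  _∧̇_
infixr 7  _∨̇_
infixr 6  _⇒_
infix  6  _⇔_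

-- The free variables are de Bruijn indices below n.

data Term (n : ℕ) : Set where
  `_      : Fin n → Term n
  𝟎       : Term n
  𝐬       : Term n → Term n
  _⊕_ _⊗_ : Term n → Term n → Term n

data Formula (n : ℕ) : Set where
  ⊥̇              : Formula n
  _≐_ _≦_        : Term n → Term n → Formula n
  _⇒_ _∧̇_ _∨̇_   : Formula n → Formula n → Formula n
  ∀̇_ ∃̇_         : Formula (suc n) → Formula n

¬̇_ : ∀ {n} → Formula n → Formula n
¬̇ φ = φ ⇒ ⊥̇

_⇔_ : ∀ {n} → Formula n → Formula n → Formula n
φ ⇔ ψ = (φ ⇒ ψ) ∧̇ (ψ ⇒ φ)

Sentence : Set
Sentence = Formula 0

Theory : (ℓ : Level) → Set (Level.suc ℓ)
Theory ℓ = Pred Sentence ℓ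

liftᵣ : ∀ {m n} → (Fin m → Fin n) → Fin (suc m) → Fin (suc n)
liftᵣ ρ zero    = zero
liftᵣ ρ (suc i) = suc (ρ i)

renameᵗ : ∀ {m n} → (Fin m → Fin n) → Term m → Term n
renameᵗ ρ (` i)   = ` ρ i
renameᵗ ρ 𝟎       = 𝟎
renameᵗ ρ (𝐬 t)   = 𝐬 (renameᵗ ρ t)
renameᵗ ρ (t ⊕ u) = renameᵗ ρ t ⊕ renameᵗ ρ u
renameᵗ ρ (t ⊗ u) = renameᵗ ρ t ⊗ renameᵗ ρ u

rename : ∀ {m n} → (Fin m → Fin n) → Formula m → Formula n
rename ρ ⊥̇       = ⊥̇
rename ρ (t ≐ u)  = renameᵗ ρ t ≐ renameᵗ ρ u
rename ρ (t ≦ u)  = renameᵗ ρ t ≦ renameᵗ ρ u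
rename ρ (φ ⇒ ψ)  = rename ρ φ ⇒ rename ρ ψ
rename ρ (φ ∧̇ ψ) = rename ρ φ ∧̇ rename ρ ψ
rename ρ (φ ∨̇ ψ) = rename ρ φ ∨̇ rename ρ ψ
rename ρ (∀̇ φ)   = ∀̇ rename (liftᵣ ρ) φ
rename ρ (∃̇ φ)   = ∃̇ rename (liftᵣ ρ) φ

liftₛ : ∀ {m n} → (Fin m → Term n) → Fin (suc m) → Term (suc n)
liftₛ σ zero    = ` zero
liftₛ σ (suc i) = renameᵗ suc (σ i)

substᵗ : ∀ {m n} → (Fin m → Term n) → Term m → Term n
substᵗ σ (` i)   = σ i
substᵗ σ 𝟎       = 𝟎
substᵗ σ (𝐬 t)   = 𝐬 (substᵗ σ t)
substᵗ σ (t ⊕ u) = substᵗ σ t ⊕ substᵗ σ u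
substᵗ σ (t ⊗ u) = substᵗ σ t ⊗ substᵗ σ u

subst : ∀ {m n} → (Fin m → Term n) → Formula m → Formula n
subst σ ⊥̇       = ⊥̇
subst σ (t ≐ u)  = substᵗ σ t ≐ substᵗ σ u
subst σ (t ≦ u)  = substᵗ σ t ≦ substᵗ σ u
subst σ (φ ⇒ ψ)  = subst σ φ ⇒ subst σ ψ
subst σ (φ ∧̇ ψ) = subst σ φ ∧̇ subst σ ψ
subst σ (φ ∨̇ ψ) = subst σ φ ∨̇ subst σ ψ
subst σ (∀̇ φ)   = ∀̇ subst (liftₛ σ) φ
subst σ (∃̇ φ)   = ∃̇ subst (liftₛ σ) φ

weaken : ∀ {n} → Formula n → Formula (suc n)
weaken = rename suc

closed : ∀ {n} → Sentence → Formula n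
closed = rename λ ()

inst : ∀ {n} → Term n → Fin (suc n) → Term n
inst t zero    = t
inst t (suc i) = ` i

infix 14 _[_]

_[_] : ∀ {n} → Formula (suc n) → Term n → Formula n
φ [ t ] = subst (inst t) φ

-- Natural deduction for classical first-order logic with equality. In
-- T ∣ Γ ⊢ φ, the non-logical axioms are T and Γ lists the open assumptions.

infix 0 _∣_⊢_ _⊢_

data _∣_⊢_ {ℓ} (T : Theory ℓ) {n : ℕ} (Γ : List (Formula n)) :
           Formula n → Set ℓ where
  axiom   : ∀ {φ} → φ ∈ T → T ∣ Γ ⊢ closed φ
  assume  : ∀ {φ} → φ ∈ˡ Γ → T ∣ Γ ⊢ φ
  raa     : ∀ {φ} → T ∣ ¬̇ φ ∷ Γ ⊢ ⊥̇ → T ∣ Γ ⊢ φ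
  ⇒-intro : ∀ {φ ψ} → T ∣ φ ∷ Γ ⊢ ψ → T ∣ Γ ⊢ φ ⇒ ψ
  ⇒-elim  : ∀ {φ ψ} → T ∣ Γ ⊢ φ ⇒ ψ → T ∣ Γ ⊢ φ → T ∣ Γ ⊢ ψ
  ∧-intro : ∀ {φ ψ} → T ∣ Γ ⊢ φ → T ∣ Γ ⊢ ψ → T ∣ Γ ⊢ φ ∧̇ ψ
  ∧-elimˡ : ∀ {φ ψ} → T ∣ Γ ⊢ φ ∧̇ ψ → T ∣ Γ ⊢ φ
  ∧-elimʳ : ∀ {φ ψ} → T ∣ Γ ⊢ φ ∧̇ ψ → T ∣ Γ ⊢ ψ
  ∨-introˡ : ∀ {φ ψ} → T ∣ Γ ⊢ φ → T ∣ Γ ⊢ φ ∨̇ ψ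
  ∨-introʳ : ∀ {φ ψ} → T ∣ Γ ⊢ ψ → T ∣ Γ ⊢ φ ∨̇ ψ
  ∨-elim  : ∀ {φ ψ χ} → T ∣ Γ ⊢ φ ∨̇ ψ →
            T ∣ φ ∷ Γ ⊢ χ → T ∣ ψ ∷ Γ ⊢ χ → T ∣ Γ ⊢ χ
  ∀-intro : ∀ {φ} → T ∣ map weaken Γ ⊢ φ → T ∣ Γ ⊢ ∀̇ φ
  ∀-elim  : ∀ {φ} t → T ∣ Γ ⊢ ∀̇ φ → T ∣ Γ ⊢ φ [ t ]
  ∃-intro : ∀ {φ} t → T ∣ Γ ⊢ φ [ t ] → T ∣ Γ ⊢ ∃̇ φ
  ∃-elim  : ∀ {φ ψ} → T ∣ Γ ⊢ ∃̇ φ →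
            T ∣ φ ∷ map weaken Γ ⊢ weaken ψ → T ∣ Γ ⊢ ψ
  ≐-refl  : ∀ t → T ∣ Γ ⊢ t ≐ t
  ≐-subst : ∀ φ {t u} → T ∣ Γ ⊢ t ≐ u → T ∣ Γ ⊢ φ [ t ] → T ∣ Γ ⊢ φ [ u ]

_⊢_ : ∀ {ℓ} → Theory ℓ → Sentence → Set ℓ
T ⊢ φ = T ∣ [] ⊢ φ

Consistent : ∀ {ℓ} → Theory ℓ → Set ℓ
Consistent T = ¬ (T ⊢ ⊥̇)

infix 4 _Extends_

_Extends_ : ∀ {ℓ ℓ′} → Theory ℓ → Theory ℓ′ → Set _
T Extends U = ∀ {φ} → φ ∈ U → T ⊢ φ

-- Robinson arithmetic, universally closed with x bound by the outermost
-- quantifier: under two binders v₁ is x and v₀ is y.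

private
  v₀ : ∀ {n} → Term (suc n)
  v₀ = ` zero

  v₁ : ∀ {n} → Term (suc (suc n))
  v₁ = ` suc zero

  v₂ : ∀ {n} → Term (suc (suc (suc n)))
  v₂ = ` suc (suc zero)

data Q : Theory 0ℓ where
  𝐬≠𝟎   : Q (∀̇ (¬̇ (𝐬 v₀ ≐ 𝟎)))
  𝐬-inj : Q (∀̇ (∀̇ (𝐬 v₁ ≐ 𝐬 v₀ ⇒ v₁ ≐ v₀)))
  pred  : Q (∀̇ (¬̇ (v₀ ≐ 𝟎) ⇒ ∃̇ (v₁ ≐ 𝐬 v₀)))
  ⊕-𝟎   : Q (∀̇ (v₀ ⊕ 𝟎 ≐ v₀))
  ⊕-𝐬   : Q (∀̇ (∀̇ (v₁ ⊕ 𝐬 v₀ ≐ 𝐬 (v₁ ⊕ v₀))))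
  ⊗-𝟎   : Q (∀̇ (v₀ ⊗ 𝟎 ≐ 𝟎))
  ⊗-𝐬   : Q (∀̇ (∀̇ (v₁ ⊗ 𝐬 v₀ ≐ v₁ ⊗ v₀ ⊕ v₁)))
  ≦-def : Q (∀̇ (∀̇ (v₁ ≦ v₀ ⇔ ∃̇ (v₀ ⊕ v₂ ≐ v₁))))

-- The pairing (a + b)² + a is injective: (a + b)² is the largest square
-- below it.

pair : ℕ → ℕ → ℕ
pair a b = (a + b) * (a + b) + a

⌜_⌝ᵗ : ∀ {n} → Term n → ℕ
⌜ ` i   ⌝ᵗ = pair 0 (toℕ i)
⌜ 𝟎     ⌝ᵗ = pair 1 0
⌜ 𝐬 t   ⌝ᵗ = pair 2 ⌜ t ⌝ᵗ
⌜ t ⊕ u ⌝ᵗ = pair 3 (pair ⌜ t ⌝ᵗ ⌜ u ⌝ᵗ)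
⌜ t ⊗ u ⌝ᵗ = pair 4 (pair ⌜ t ⌝ᵗ ⌜ u ⌝ᵗ)

⌜_⌝ : ∀ {n} → Formula n → ℕ
⌜ ⊥̇     ⌝ = pair 0 0
⌜ t ≐ u  ⌝ = pair 1 (pair ⌜ t ⌝ᵗ ⌜ u ⌝ᵗ)
⌜ t ≦ u  ⌝ = pair 2 (pair ⌜ t ⌝ᵗ ⌜ u ⌝ᵗ)
⌜ φ ⇒ ψ  ⌝ = pair 3 (pair ⌜ φ ⌝ ⌜ ψ ⌝)
⌜ φ ∧̇ ψ ⌝ = pair 4 (pair ⌜ φ ⌝ ⌜ ψ ⌝)
⌜ φ ∨̇ ψ ⌝ = pair 5 (pair ⌜ φ ⌝ ⌜ ψ ⌝)
⌜ ∀̇ φ   ⌝ = pair 6 ⌜ φ ⌝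
⌜ ∃̇ φ   ⌝ = pair 7 ⌜ φ ⌝

TheoremNumbers : ∀ {ℓ} → Theory ℓ → Pred ℕ ℓ
TheoremNumbers T n = ∃[ φ ] (T ⊢ φ) × ⌜ φ ⌝ ≡ n

-- Kleene's μ-recursive functions: f ⟨ xs ⟩↦ y says that the partial function
-- denoted by f is defined at xs with value y.

data Rec : ℕ → Set where
  zero : ∀ {n} → Rec n
  succ : Rec 1
  proj : ∀ {n} → Fin n → Rec n
  comp : ∀ {m n} → Rec m → Vec (Rec n) m → Rec n
  prec : ∀ {n} → Rec n → Rec (suc (suc n)) → Rec (suc n)
  μ    : ∀ {n} → Rec (suc n) → Rec n

infix 4 _⟨_⟩↦_

data _⟨_⟩↦_ : ∀ {n} → Rec n → Vec ℕ n → ℕ → Set where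
  zero  : ∀ {n} {xs : Vec ℕ n} → zero ⟨ xs ⟩↦ 0
  succ  : ∀ {x} → succ ⟨ x ∷ [] ⟩↦ suc x
  proj  : ∀ {n} {xs : Vec ℕ n} i → proj i ⟨ xs ⟩↦ lookup xs i
  comp  : ∀ {m n} {f : Rec m} {gs : Vec (Rec n) m} {xs ys z} →
          Pointwise (λ g y → g ⟨ xs ⟩↦ y) gs ys →
          f ⟨ ys ⟩↦ z → comp f gs ⟨ xs ⟩↦ z
  prec₀ : ∀ {n} {f : Rec n} {g xs y} →
          f ⟨ xs ⟩↦ y → prec f g ⟨ 0 ∷ xs ⟩↦ y
  precₛ : ∀ {n} {f : Rec n} {g k xs y z} →
          prec f g ⟨ k ∷ xs ⟩↦ y →
          g ⟨ k ∷ y ∷ xs ⟩↦ z → prec f g ⟨ suc k ∷ xs ⟩↦ z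
  μ     : ∀ {n} {f : Rec (suc n)} {xs y} →
          (∀ {i} → i < y → ∃[ k ] f ⟨ i ∷ xs ⟩↦ suc k) →
          f ⟨ y ∷ xs ⟩↦ 0 → μ f ⟨ xs ⟩↦ y

-- The characteristic function of S is μ-recursive. The two clauses are kept
-- apart, instead of asking for n ∈ S or n ∉ S, so that S need not be decidable
-- in Agda: read classically, they make f total with values in {0, 1}.

Recursive : ∀ {ℓ} → Pred ℕ ℓ → Set ℓ
Recursive S = ∃[ f ] ∀ n → (n ∈ S → f ⟨ n ∷ [] ⟩↦ 1) × (n ∉ S → f ⟨ n ∷ [] ⟩↦ 0)

Undecidable : ∀ {ℓ} → Theory ℓ → Set ℓ
Undecidable T = ¬ Recursive (TheoremNumbers T)

{-# OPTIONS --safe #-}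

-- Q decides every relation built from equations between terms by connectives
-- and bounded quantifiers. The graph of a recursive function is the projection
-- of such a relation: some bound w on the numbers occurring in a computation
-- makes it true. Given g, Rosser's device yields a formula ψ(x), "some w bounds
-- a computation of g(x) = 0 and no v ≤ w bounds one of g(x) = 1", such that Q
-- proves ψ(x) when g(x) = 0 and refutes it when g(x) = 1. If f decided the
-- theorems of T, take g to be f after the diagonal function ⌜ψ⌝ ↦ ⌜θ⌝, where θ is
-- ∀ x (x = ⌜ψ⌝ → ψ(x)): then T refutes θ if it proves θ, and proves it if not.
module Submission where

open import Data.Empty using (⊥)
open import Data.Fin.Base using (Fin; zero; suc; toℕ)
open import Data.Fin.Properties using (toℕ-injective)
open import Data.List.Base using (List; []; _∷_; map; _++_)
open import Data.List.Membership.Propositional using () renaming (_∈_ to _∈ˡ_)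
open import Data.List.Membership.Propositional.Properties using (∈-++⁺ˡ; ∈-++⁺ʳ; ∈-map⁺; ∈-map⁻)
open import Data.List.Properties using (map-++)
open import Data.List.Relation.Unary.All using (All; []; _∷_; tabulate)
open import Data.List.Relation.Unary.All.Properties using (map⁺)
open import Data.List.Relation.Unary.Any using (here; there)
open import Data.Nat.Base
  using (ℕ; zero; suc; _+_; _*_; _∸_; _⊔_; _!; _≤_; _<_; z≤n; s≤s; ≢-nonZero⁻¹)
open import Data.Nat.Coprimality using (Coprime; coprime-divisor) renaming (sym to coprime-sym)
open import Data.Nat.Divisibility
  using (divides; ∣-trans; ∣1⇒≡1; ∣m+n∣m⇒∣n; ∣n⇒∣m*n; m∣m*n; m≤n⇒m!∣n!)
  renaming (_∣_ to _∣ⁿ_)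
open import Data.Nat.ListAction using (product)
open import Data.Nat.ListAction.Properties using (∈⇒∣product)
open import Data.Nat.Properties
open import Data.Product.Base using (_×_; _,_; proj₁; proj₂; ∃-syntax)
open import Data.Sum.Base using (_⊎_; inj₁; inj₂; swap)
open import Data.Vec.Base using (Vec; []; _∷_; lookup; head; tail)
open import Data.Vec.Relation.Binary.Pointwise.Inductive using (Pointwise; []; _∷_)
open import Function.Base using (_∘_; id)
open import Relation.Binary.Definitions using (tri<; tri≈; tri>)
open import Relation.Binary.PropositionalEquality
  using (_≡_; _≢_; _≗_; refl; sym; trans; cong; cong₂; module ≡-Reasoning)
  renaming (subst to transport)
open import Relation.Nullary.Decidable.Core using (yes; no)
open import Relation.Nullary.Negation.Core using (¬_; contradiction)

open import Defs

-- Only consistency is assumed of `T`, not truth, so `Q` itself has to refute `ψ(x)` when g(x) = 1.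
-- The plain formula "some w bounds a computation of g(x) = 0" would not do: no standard `w`
-- satisfies it then, but `Q` has no induction and may leave open a nonstandard one. What `Q` can do
-- is compare an arbitrary element with a fixed numeral, and show that whatever lies below the
-- numeral is itself a numeral. Rosser's clause reduces the refutation to these two facts, provided
-- that the matrix is decided at numerals. Hence all witnesses of a computation are placed under the
-- single bound `w`, which leaves only bounded quantifiers in the matrix.

private variable
  k m n : ℕ
  Γ : List (Formula n)
  φ ψ χ : Formula n
  t t′ u u′ v : Term n

-- Substitution

↑_ : Term n → Term (suc n)
↑_ = renameᵗ suc

infix 14 ↑_

substᵗ-cong : {σ τ : Fin m → Term n} → σ ≗ τ → substᵗ σ ≗ substᵗ τ
substᵗ-cong e (` i)   = e i
substᵗ-cong e 𝟎       = refl
substᵗ-cong e (𝐬 t)   = cong 𝐬 (substᵗ-cong e t)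
substᵗ-cong e (t ⊕ u) = cong₂ _⊕_ (substᵗ-cong e t) (substᵗ-cong e u)
substᵗ-cong e (t ⊗ u) = cong₂ _⊗_ (substᵗ-cong e t) (substᵗ-cong e u)

substᵗ-renameᵗ : (σ : Fin m → Term n) (ρ : Fin k → Fin m) (t : Term k) →
                 substᵗ σ (renameᵗ ρ t) ≡ substᵗ (λ i → σ (ρ i)) t
substᵗ-renameᵗ σ ρ (` i)   = refl
substᵗ-renameᵗ σ ρ 𝟎       = refl
substᵗ-renameᵗ σ ρ (𝐬 t)   = cong 𝐬 (substᵗ-renameᵗ σ ρ t)
substᵗ-renameᵗ σ ρ (t ⊕ u) = cong₂ _⊕_ (substᵗ-renameᵗ σ ρ t) (substᵗ-renameᵗ σ ρ u)
substᵗ-renameᵗ σ ρ (t ⊗ u) = cong₂ _⊗_ (substᵗ-renameᵗ σ ρ t) (substᵗ-renameᵗ σ ρ u)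

renameᵗ-substᵗ : (ρ : Fin m → Fin n) (σ : Fin k → Term m) (t : Term k) →
                 renameᵗ ρ (substᵗ σ t) ≡ substᵗ (λ i → renameᵗ ρ (σ i)) t
renameᵗ-substᵗ ρ σ (` i)   = refl
renameᵗ-substᵗ ρ σ 𝟎       = refl
renameᵗ-substᵗ ρ σ (𝐬 t)   = cong 𝐬 (renameᵗ-substᵗ ρ σ t)
renameᵗ-substᵗ ρ σ (t ⊕ u) = cong₂ _⊕_ (renameᵗ-substᵗ ρ σ t) (renameᵗ-substᵗ ρ σ u)
renameᵗ-substᵗ ρ σ (t ⊗ u) = cong₂ _⊗_ (renameᵗ-substᵗ ρ σ t) (renameᵗ-substᵗ ρ σ u)

substᵗ-id : (t : Term n) → substᵗ `_ t ≡ t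
substᵗ-id (` i)   = refl
substᵗ-id 𝟎       = refl
substᵗ-id (𝐬 t)   = cong 𝐬 (substᵗ-id t)
substᵗ-id (t ⊕ u) = cong₂ _⊕_ (substᵗ-id t) (substᵗ-id u)
substᵗ-id (t ⊗ u) = cong₂ _⊗_ (substᵗ-id t) (substᵗ-id u)

substᵗ-substᵗ : (σ : Fin m → Term n) (τ : Fin k → Term m) (t : Term k) →
                substᵗ σ (substᵗ τ t) ≡ substᵗ (λ i → substᵗ σ (τ i)) t
substᵗ-substᵗ σ τ (` i)   = refl
substᵗ-substᵗ σ τ 𝟎       = refl
substᵗ-substᵗ σ τ (𝐬 t)   = cong 𝐬 (substᵗ-substᵗ σ τ t)
substᵗ-substᵗ σ τ (t ⊕ u) = cong₂ _⊕_ (substᵗ-substᵗ σ τ t) (substᵗ-substᵗ σ τ u)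
substᵗ-substᵗ σ τ (t ⊗ u) = cong₂ _⊗_ (substᵗ-substᵗ σ τ t) (substᵗ-substᵗ σ τ u)

liftₛ-cong : {σ τ : Fin m → Term n} → σ ≗ τ → liftₛ σ ≗ liftₛ τ
liftₛ-cong e zero    = refl
liftₛ-cong e (suc i) = cong ↑_ (e i)

subst-cong : {σ τ : Fin m → Term n} → σ ≗ τ → subst σ ≗ subst τ
subst-cong e ⊥̇        = refl
subst-cong e (t ≐ u)  = cong₂ _≐_ (substᵗ-cong e t) (substᵗ-cong e u)
subst-cong e (t ≦ u)  = cong₂ _≦_ (substᵗ-cong e t) (substᵗ-cong e u)
subst-cong e (φ ⇒ ψ)  = cong₂ _⇒_ (subst-cong e φ) (subst-cong e ψ)
subst-cong e (φ ∧̇ ψ)  = cong₂ _∧̇_ (subst-cong e φ) (subst-cong e ψ)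
subst-cong e (φ ∨̇ ψ)  = cong₂ _∨̇_ (subst-cong e φ) (subst-cong e ψ)
subst-cong e (∀̇ φ)    = cong ∀̇_ (subst-cong (liftₛ-cong e) φ)
subst-cong e (∃̇ φ)    = cong ∃̇_ (subst-cong (liftₛ-cong e) φ)

substᵗ-liftₛ : (σ : Fin m → Term n) (τ : Fin k → Term m) →
               (λ i → substᵗ (liftₛ σ) (liftₛ τ i)) ≗ liftₛ (λ i → substᵗ σ (τ i))
substᵗ-liftₛ σ τ zero    = refl
substᵗ-liftₛ σ τ (suc i) =
  trans (substᵗ-renameᵗ (liftₛ σ) suc (τ i)) (sym (renameᵗ-substᵗ suc σ (τ i)))

substᵗ-liftₛ-↑ : (σ : Fin m → Term n) (t : Term m) →
                 substᵗ (liftₛ σ) (↑ t) ≡ ↑ (substᵗ σ t)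
substᵗ-liftₛ-↑ σ t =
  trans (substᵗ-renameᵗ (liftₛ σ) suc t) (sym (renameᵗ-substᵗ suc σ t))

subst-subst : (σ : Fin m → Term n) (τ : Fin k → Term m) (φ : Formula k) →
              subst σ (subst τ φ) ≡ subst (λ i → substᵗ σ (τ i)) φ
subst-subst σ τ ⊥̇       = refl
subst-subst σ τ (t ≐ u) = cong₂ _≐_ (substᵗ-substᵗ σ τ t) (substᵗ-substᵗ σ τ u)
subst-subst σ τ (t ≦ u) = cong₂ _≦_ (substᵗ-substᵗ σ τ t) (substᵗ-substᵗ σ τ u)
subst-subst σ τ (φ ⇒ ψ) = cong₂ _⇒_ (subst-subst σ τ φ) (subst-subst σ τ ψ)
subst-subst σ τ (φ ∧̇ ψ) = cong₂ _∧̇_ (subst-subst σ τ φ) (subst-subst σ τ ψ)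
subst-subst σ τ (φ ∨̇ ψ) = cong₂ _∨̇_ (subst-subst σ τ φ) (subst-subst σ τ ψ)
subst-subst σ τ (∀̇ φ)   = cong ∀̇_
  (trans (subst-subst (liftₛ σ) (liftₛ τ) φ) (subst-cong (substᵗ-liftₛ σ τ) φ))
subst-subst σ τ (∃̇ φ)   = cong ∃̇_
  (trans (subst-subst (liftₛ σ) (liftₛ τ) φ) (subst-cong (substᵗ-liftₛ σ τ) φ))

inst-↑ : (u t : Term n) → substᵗ (inst u) (↑ t) ≡ t
inst-↑ u t = trans (substᵗ-renameᵗ (inst u) suc t) (substᵗ-id t)

infixr 5 _∷ₛ_

_∷ₛ_ : Term n → (Fin m → Term n) → Fin (suc m) → Term n
(t ∷ₛ σ) zero    = t
(t ∷ₛ σ) (suc i) = σ i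

inst-liftₛ : (t : Term n) (σ : Fin m → Term n) →
             (λ i → substᵗ (inst t) (liftₛ σ i)) ≗ t ∷ₛ σ
inst-liftₛ t σ zero    = refl
inst-liftₛ t σ (suc i) = inst-↑ t (σ i)

subst-liftₛ-inst : (t : Term n) (σ : Fin m → Term n) (φ : Formula (suc m)) →
                   subst (liftₛ σ) φ [ t ] ≡ subst (t ∷ₛ σ) φ
subst-liftₛ-inst t σ φ =
  trans (subst-subst (inst t) (liftₛ σ) φ) (subst-cong (inst-liftₛ t σ) φ)

substᵗ-liftₛ-inst : (t : Term n) (σ : Fin m → Term n) (u : Term m) →
                    substᵗ (inst t) (substᵗ (liftₛ σ) (↑ u)) ≡ substᵗ σ u
substᵗ-liftₛ-inst t σ u = trans (substᵗ-substᵗ (inst t) (liftₛ σ) (↑ u))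
  (trans (substᵗ-cong (inst-liftₛ t σ) (↑ u)) (substᵗ-renameᵗ (t ∷ₛ σ) suc u))

-- Logic with equality

module _ {ℓ} {T : Theory ℓ} where

  hyp₀ : T ∣ φ ∷ Γ ⊢ φ
  hyp₀ = assume (here refl)

  hyp₁ : T ∣ ψ ∷ φ ∷ Γ ⊢ φ
  hyp₁ = assume (there (here refl))

  hyp₂ : T ∣ χ ∷ ψ ∷ φ ∷ Γ ⊢ φ
  hyp₂ = assume (there (there (here refl)))

  cast : φ ≡ ψ → T ∣ Γ ⊢ φ → T ∣ Γ ⊢ ψ
  cast {Γ = Γ} = transport (T ∣ Γ ⊢_)

  ex-falso : T ∣ Γ ⊢ ⊥̇ ⇒ φ
  ex-falso = ⇒-intro (raa hyp₁)

  ⊥-elim′ : T ∣ Γ ⊢ ⊥̇ → T ∣ Γ ⊢ φ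
  ⊥-elim′ = ⇒-elim ex-falso

  excluded-middle : (φ : Formula n) → T ∣ Γ ⊢ φ ∨̇ ¬̇ φ
  excluded-middle φ = raa (⇒-elim hyp₀
    (∨-introʳ (⇒-intro (⇒-elim hyp₁ (∨-introˡ hyp₀)))))

  -- Storing the branches as implications spares a weakening lemma.
  ∨-rec : T ∣ Γ ⊢ φ ⇒ χ → T ∣ Γ ⊢ ψ ⇒ χ → T ∣ Γ ⊢ φ ∨̇ ψ ⇒ χ
  ∨-rec d e = ⇒-elim (⇒-elim
    (⇒-intro (⇒-intro (⇒-intro (∨-elim hyp₀
      (⇒-elim (assume (there (there (there (here refl))))) hyp₀)
      (⇒-elim hyp₂ hyp₀))))) d) e

  ⇒-trans : T ∣ Γ ⊢ φ ⇒ ψ → T ∣ Γ ⊢ ψ ⇒ χ → T ∣ Γ ⊢ φ ⇒ χ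
  ⇒-trans d e = ⇒-elim (⇒-elim
    (⇒-intro (⇒-intro (⇒-intro (⇒-elim hyp₁ (⇒-elim hyp₂ hyp₀))))) d) e

  ≐-cong : ∀ s → T ∣ Γ ⊢ t ≐ u → T ∣ Γ ⊢ substᵗ (inst t) s ≐ substᵗ (inst u) s
  ≐-cong {t = t} {u} s e =
    cast (cong (_≐ substᵗ (inst u) s) (inst-↑ u _))
      -- The substitution undoes `↑` on the left side, so only the right side is rewritten, starting
      -- from reflexivity.
      (≐-subst (↑ substᵗ (inst t) s ≐ s) e
        (cast (cong (_≐ substᵗ (inst t) s) (sym (inst-↑ t _))) (≐-refl _)))

  ≐-sym : T ∣ Γ ⊢ t ≐ u → T ∣ Γ ⊢ u ≐ t
  ≐-sym {t = t} {u} e = cast (cong (u ≐_) (inst-↑ u t))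
    (≐-subst (` zero ≐ ↑ t) e (cast (cong (t ≐_) (sym (inst-↑ t t))) (≐-refl t)))

  ≐-trans : T ∣ Γ ⊢ t ≐ u → T ∣ Γ ⊢ u ≐ v → T ∣ Γ ⊢ t ≐ v
  ≐-trans {t = t} {u} {v} d e = cast (cong (_≐ v) (inst-↑ v t))
    (≐-subst (↑ t ≐ ` zero) e (cast (cong (_≐ u) (sym (inst-↑ u t))) d))

  𝐬-cong : T ∣ Γ ⊢ t ≐ u → T ∣ Γ ⊢ 𝐬 t ≐ 𝐬 u
  𝐬-cong = ≐-cong (𝐬 (` zero))

  ⊕-cong : T ∣ Γ ⊢ t ≐ t′ → T ∣ Γ ⊢ u ≐ u′ → T ∣ Γ ⊢ t ⊕ u ≐ t′ ⊕ u′
  ⊕-cong {t = t} {t′} {u} {u′} d e = ≐-trans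
    (cast (cong₂ (λ a b → t ⊕ a ≐ t′ ⊕ b) (inst-↑ t u) (inst-↑ t′ u)) (≐-cong (` zero ⊕ ↑ u) d))
    (cast (cong₂ (λ a b → a ⊕ u ≐ b ⊕ u′) (inst-↑ u t′) (inst-↑ u′ t′)) (≐-cong (↑ t′ ⊕ ` zero) e))

  ⊗-cong : T ∣ Γ ⊢ t ≐ t′ → T ∣ Γ ⊢ u ≐ u′ → T ∣ Γ ⊢ t ⊗ u ≐ t′ ⊗ u′
  ⊗-cong {t = t} {t′} {u} {u′} d e = ≐-trans
    (cast (cong₂ (λ a b → t ⊗ a ≐ t′ ⊗ b) (inst-↑ t u) (inst-↑ t′ u)) (≐-cong (` zero ⊗ ↑ u) d))
    (cast (cong₂ (λ a b → a ⊗ u ≐ b ⊗ u′) (inst-↑ u t′) (inst-↑ u′ t′)) (≐-cong (↑ t′ ⊗ ` zero) e))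

  ≦-resp : T ∣ Γ ⊢ t ≐ t′ → T ∣ Γ ⊢ u ≐ u′ → T ∣ Γ ⊢ t ≦ u → T ∣ Γ ⊢ t′ ≦ u′
  ≦-resp {t = t} {t′} {u} {u′} d e p =
    cast (cong (_≦ u′) (inst-↑ u′ t′)) (≐-subst (↑ t′ ≦ ` zero) e
      (cast (cong₂ _≦_ (sym (inst-↑ u t′)) (inst-↑ t′ u)) (≐-subst (` zero ≦ ↑ u) d
        (cast (cong (t ≦_) (sym (inst-↑ t u))) p))))

-- Robinson arithmetic

𝐬≐𝟎-elim : Q ∣ Γ ⊢ 𝐬 t ≐ 𝟎 → Q ∣ Γ ⊢ φ
𝐬≐𝟎-elim {t = t} d = ⊥-elim′ (⇒-elim (∀-elim t (axiom 𝐬≠𝟎)) d)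

𝐬-injective : Q ∣ Γ ⊢ 𝐬 t ≐ 𝐬 u → Q ∣ Γ ⊢ t ≐ u
𝐬-injective {t = t} {u} = ⇒-elim
  (cast (cong (λ a → 𝐬 a ≐ 𝐬 u ⇒ a ≐ u) (inst-↑ u t)) (∀-elim u (∀-elim t (axiom 𝐬-inj))))

𝟎-or-𝐬 : (t : Term n) → Q ∣ Γ ⊢ t ≐ 𝟎 ∨̇ ∃̇ (↑ t ≐ 𝐬 (` zero))
𝟎-or-𝐬 t = ∨-elim (excluded-middle (t ≐ 𝟎)) (∨-introˡ hyp₀)
  (∨-introʳ (⇒-elim (∀-elim t (axiom pred)) hyp₀))

⊕-zero : (t : Term n) → Q ∣ Γ ⊢ t ⊕ 𝟎 ≐ t
⊕-zero t = ∀-elim t (axiom ⊕-𝟎)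

⊕-suc : (t u : Term n) → Q ∣ Γ ⊢ t ⊕ 𝐬 u ≐ 𝐬 (t ⊕ u)
⊕-suc t u = cast (cong (λ a → a ⊕ 𝐬 u ≐ 𝐬 (a ⊕ u)) (inst-↑ u t))
  (∀-elim u (∀-elim t (axiom ⊕-𝐬)))

⊗-zero : (t : Term n) → Q ∣ Γ ⊢ t ⊗ 𝟎 ≐ 𝟎
⊗-zero t = ∀-elim t (axiom ⊗-𝟎)

⊗-suc : (t u : Term n) → Q ∣ Γ ⊢ t ⊗ 𝐬 u ≐ t ⊗ u ⊕ t
⊗-suc t u = cast (cong (λ a → a ⊗ 𝐬 u ≐ a ⊗ u ⊕ a) (inst-↑ u t))
  (∀-elim u (∀-elim t (axiom ⊗-𝐬)))

≦-definition : (t u : Term n) → Q ∣ Γ ⊢ t ≦ u ⇔ ∃̇ (` zero ⊕ ↑ t ≐ ↑ u)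
≦-definition t u = cast (cong₂ (λ a b → a ≦ u ⇔ ∃̇ (` zero ⊕ b ≐ ↑ u)) (inst-↑ u t)
    (trans (substᵗ-liftₛ-↑ (inst u) (↑ t)) (cong ↑_ (inst-↑ u t))))
  (∀-elim u (∀-elim t (axiom ≦-def)))

≦-intro : ∀ v → Q ∣ Γ ⊢ v ⊕ t ≐ u → Q ∣ Γ ⊢ t ≦ u
≦-intro {t = t} {u} v d = ⇒-elim (∧-elimʳ (≦-definition t u))
  (∃-intro v (cast (sym (cong₂ (λ a b → v ⊕ a ≐ b) (inst-↑ v t) (inst-↑ v u))) d))

≦-elim : Q ∣ Γ ⊢ t ≦ u → Q ∣ ` zero ⊕ ↑ t ≐ ↑ u ∷ map weaken Γ ⊢ weaken φ → Q ∣ Γ ⊢ φ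
≦-elim {t = t} {u} d = ∃-elim (⇒-elim (∧-elimˡ (≦-definition t u)) d)

𝟎≦ : (t : Term n) → Q ∣ Γ ⊢ 𝟎 ≦ t
𝟎≦ t = ≦-intro t (⊕-zero t)

𝐬≦𝟎-elim : Q ∣ Γ ⊢ 𝐬 t ≦ 𝟎 → Q ∣ Γ ⊢ φ
𝐬≦𝟎-elim d = ≦-elim d (𝐬≐𝟎-elim (≐-trans (≐-sym (⊕-suc _ _)) hyp₀))

-- In `z + x = y` the smaller number `x` stands where the axioms for `⊕` recurse, so the same `z`
-- serves before and after the successor.
𝐬-mono-≦ : Q ∣ Γ ⊢ t ≦ u → Q ∣ Γ ⊢ 𝐬 t ≦ 𝐬 u
𝐬-mono-≦ d = ≦-elim d (≦-intro (` zero) (≐-trans (⊕-suc _ _) (𝐬-cong hyp₀)))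

𝐬-cancel-≦ : Q ∣ Γ ⊢ 𝐬 t ≦ 𝐬 u → Q ∣ Γ ⊢ t ≦ u
𝐬-cancel-≦ d = ≦-elim d
  (≦-intro (` zero) (𝐬-injective (≐-trans (≐-sym (⊕-suc _ _)) hyp₀)))

-- Numerals and their order

num : ℕ → Term n
num zero    = 𝟎
num (suc a) = 𝐬 (num a)

renameᵗ-num : (ρ : Fin m → Fin n) → ∀ a → renameᵗ ρ (num a) ≡ num a
renameᵗ-num ρ zero    = refl
renameᵗ-num ρ (suc a) = cong 𝐬 (renameᵗ-num ρ a)

substᵗ-num : (σ : Fin m → Term n) → ∀ a → substᵗ σ (num a) ≡ num a
substᵗ-num σ zero    = refl
substᵗ-num σ (suc a) = cong 𝐬 (substᵗ-num σ a)

num-⊕ : ∀ a b → Q ∣ Γ ⊢ num a ⊕ num b ≐ num (a + b)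
num-⊕ a zero    = cast (cong (λ c → num a ⊕ 𝟎 ≐ num c) (sym (+-identityʳ a))) (⊕-zero (num a))
num-⊕ a (suc b) = cast (cong (λ c → num a ⊕ 𝐬 (num b) ≐ num c) (sym (+-suc a b)))
  (≐-trans (⊕-suc _ _) (𝐬-cong (num-⊕ a b)))

num-⊗ : ∀ a b → Q ∣ Γ ⊢ num a ⊗ num b ≐ num (a * b)
num-⊗ a zero    = cast (cong (λ c → num a ⊗ 𝟎 ≐ num c) (sym (*-zeroʳ a))) (⊗-zero (num a))
num-⊗ a (suc b) = cast
  (cong (λ c → num a ⊗ 𝐬 (num b) ≐ num c) (trans (+-comm (a * b) a) (sym (*-suc a b))))
  (≐-trans (⊗-suc _ _) (≐-trans (⊕-cong (num-⊗ a b) (≐-refl _)) (num-⊕ (a * b) a)))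

num-≐-elim : ∀ a b → a ≢ b → Q ∣ Γ ⊢ num a ≐ num b → Q ∣ Γ ⊢ φ
num-≐-elim zero    zero    a≢b d = contradiction refl a≢b
num-≐-elim zero    (suc b) a≢b d = 𝐬≐𝟎-elim (≐-sym d)
num-≐-elim (suc a) zero    a≢b d = 𝐬≐𝟎-elim d
num-≐-elim (suc a) (suc b) a≢b d = num-≐-elim a b (λ e → a≢b (cong suc e)) (𝐬-injective d)

num-≦ : ∀ {a b} → a ≤ b → Q ∣ Γ ⊢ num a ≦ num b
num-≦ {a = a} {b} a≤b = ≦-intro (num (b ∸ a))
  (cast (cong (λ c → num (b ∸ a) ⊕ num a ≐ num c) (m∸n+n≡m a≤b)) (num-⊕ (b ∸ a) a))

infix 10 _≐num≤_

_≐num≤_ : Term n → ℕ → Formula n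
t ≐num≤ zero  = t ≐ 𝟎
t ≐num≤ suc b = t ≐num≤ b ∨̇ t ≐ num (suc b)

weaken-≐num≤ : (t : Term n) → ∀ b → weaken (t ≐num≤ b) ≡ ↑ t ≐num≤ b
weaken-≐num≤ t zero    = refl
weaken-≐num≤ t (suc b) =
  cong₂ (λ φ a → φ ∨̇ ↑ t ≐ a) (weaken-≐num≤ t b) (renameᵗ-num suc (suc b))

≐num≤-intro : ∀ {a b} → a ≤ b → Q ∣ Γ ⊢ t ≐ num a → Q ∣ Γ ⊢ t ≐num≤ b
≐num≤-intro {b = zero}  z≤n d = d
≐num≤-intro {b = suc b} a≤b d with m≤n⇒m<n∨m≡n a≤b
... | inj₁ (s≤s a≤b′) = ∨-introˡ (≐num≤-intro a≤b′ d)
... | inj₂ refl       = ∨-introʳ d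

≐num≤-elim : ∀ b → (∀ a → a ≤ b → Q ∣ Γ ⊢ t ≐ num a ⇒ φ) → Q ∣ Γ ⊢ t ≐num≤ b ⇒ φ
≐num≤-elim zero    d = d 0 z≤n
≐num≤-elim (suc b) d =
  ∨-rec (≐num≤-elim b (λ a a≤b → d a (m≤n⇒m≤1+n a≤b))) (d (suc b) ≤-refl)

-- Q has no induction: the recursion is on the metatheoretic b, and the axiom
-- x ≠ 0 → ∃ y (x = s y) provides the case distinction on t.
≦num⇒≐num≤ : ∀ b (t : Term n) → Q ∣ Γ ⊢ t ≦ num b ⇒ t ≐num≤ b

𝐬≦num⇒≐num≤ : ∀ b → Q ∣ t ≐ 𝐬 u ∷ Γ ⊢ 𝐬 u ≦ num b → Q ∣ t ≐ 𝐬 u ∷ Γ ⊢ t ≐num≤ b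

≦num⇒≐num≤ b t = ⇒-intro (∨-elim (𝟎-or-𝐬 t) (≐num≤-intro z≤n hyp₀)
  (∃-elim hyp₀ (cast (sym (weaken-≐num≤ t b))
    (𝐬≦num⇒≐num≤ b (≦-resp hyp₀ (≐-refl _) (cast (cong (↑ t ≦_) (renameᵗ-num suc b)) hyp₂))))))

𝐬≦num⇒≐num≤ zero    d = 𝐬≦𝟎-elim d
𝐬≦num⇒≐num≤ (suc b) d = ⇒-elim
  (≐num≤-elim b λ a a≤b → ⇒-intro (≐num≤-intro (s≤s a≤b) (≐-trans hyp₁ (𝐬-cong hyp₀))))
  (⇒-elim (≦num⇒≐num≤ b _) (𝐬-cancel-≦ d))

≦num-elim : ∀ b → (∀ a → a ≤ b → Q ∣ Γ ⊢ t ≐ num a ⇒ φ) → Q ∣ Γ ⊢ t ≦ num b ⇒ φ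
≦num-elim b d = ⇒-trans (≦num⇒≐num≤ b _) (≐num≤-elim b d)

-- `Q` does not prove its order total, but comparison with a numeral succeeds: the recursion strips
-- one successor from both sides until one of them is zero.
≦num-total : ∀ b (t : Term n) → Q ∣ Γ ⊢ t ≦ num b ∨̇ num b ≦ t
≦num-total zero    t = ∨-introʳ (𝟎≦ t)
≦num-total (suc b) t = ∨-elim (𝟎-or-𝐬 t)
  (∨-introˡ (≦-resp (≐-sym hyp₀) (≐-refl _) (𝟎≦ _)))
  (∃-elim hyp₀ (cast (cong (λ a → ↑ t ≦ 𝐬 a ∨̇ 𝐬 a ≦ ↑ t) (sym (renameᵗ-num suc b)))
    (∨-elim (≦num-total b (` zero))
      (∨-introˡ (≦-resp (≐-sym hyp₁) (≐-refl _) (𝐬-mono-≦ hyp₀)))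
      (∨-introʳ (≦-resp (≐-refl _) (≐-sym hyp₁) (𝐬-mono-≦ hyp₀))))))

-- Relations decided by Q at numerals

nums : Vec ℕ m → Fin m → Term n
nums ρ i = num (lookup ρ i)

-- The context and the number of ambient variables stay arbitrary, so that a decision can be used
-- under further assumptions and binders without weakening derivations.
Provable Refutable : Vec ℕ m → Formula m → Set
Provable  ρ φ = ∀ {n} {Γ : List (Formula n)} → Q ∣ Γ ⊢ subst (nums ρ) φ
Refutable ρ φ = ∀ {n} {Γ : List (Formula n)} → Q ∣ Γ ⊢ ¬̇ subst (nums ρ) φ

-- Only polynomials arise in this way, among them `pair` and `modulus`; other functions enter
-- through their bounded graphs.
record TermFn {m} (F : Vec ℕ m → ℕ) : Set where
  field
    term : Term m
    eval : ∀ ρ {n} {Γ : List (Formula n)} → Q ∣ Γ ⊢ substᵗ (nums ρ) term ≐ num (F ρ)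

record Expressible {m} (R : Vec ℕ m → Set) : Set where
  field
    formula : Formula m
    decide  : ∀ ρ → (R ρ × Provable ρ formula) ⊎ (¬ R ρ × Refutable ρ formula)

  provable : ∀ ρ → R ρ → Provable ρ formula
  provable ρ r with decide ρ
  ... | inj₁ (_ , p)  = p
  ... | inj₂ (¬r , _) = contradiction r ¬r

  refutable : ∀ ρ → ¬ R ρ → Refutable ρ formula
  refutable ρ ¬r with decide ρ
  ... | inj₁ (r , _) = contradiction r ¬r
  ... | inj₂ (_ , d) = d

open TermFn
open Expressible

private variable
  A B F H I J W Y : Vec ℕ m → ℕ
  R S : Vec ℕ m → Set

-- Closure properties of expressible relations

headᶠ : TermFn {suc m} head
term headᶠ = ` zero
eval headᶠ (x ∷ ρ) = ≐-refl _

tailᶠ : TermFn F → TermFn {suc m} (λ ρ → F (tail ρ))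
term (tailᶠ f) = ↑ term f
eval (tailᶠ {F = F} f) (x ∷ ρ) =
  cast (cong (_≐ num (F ρ)) (sym (substᵗ-renameᵗ (nums (x ∷ ρ)) suc (term f)))) (eval f ρ)

0ᶠ : TermFn {m} (λ ρ → 0)
term 0ᶠ = 𝟎
eval 0ᶠ ρ = ≐-refl _

sucᶠ : TermFn F → TermFn (λ ρ → suc (F ρ))
term (sucᶠ f) = 𝐬 (term f)
eval (sucᶠ f) ρ = 𝐬-cong (eval f ρ)

infixl 6 _+ᶠ_
infixl 7 _*ᶠ_

_+ᶠ_ : TermFn F → TermFn H → TermFn (λ ρ → F ρ + H ρ)
term (f +ᶠ g) = term f ⊕ term g
eval (f +ᶠ g) ρ = ≐-trans (⊕-cong (eval f ρ) (eval g ρ)) (num-⊕ _ _)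

_*ᶠ_ : TermFn F → TermFn H → TermFn (λ ρ → F ρ * H ρ)
term (f *ᶠ g) = term f ⊗ term g
eval (f *ᶠ g) ρ = ≐-trans (⊗-cong (eval f ρ) (eval g ρ)) (num-⊗ _ _)

infix  4 _≡ᵉ_
infixr 3 _∧ᵉ_
infixr 2 _⇒ᵉ_

_≡ᵉ_ : TermFn F → TermFn H → Expressible (λ ρ → F ρ ≡ H ρ)
formula (f ≡ᵉ g) = term f ≐ term g
decide (_≡ᵉ_ {F = F} {H} f g) ρ with F ρ ≟ H ρ
... | yes e = inj₁ (e , ≐-trans (eval f ρ)
  (≐-trans (cast (cong (λ a → num (F ρ) ≐ num a) e) (≐-refl _)) (≐-sym (eval g ρ))))
... | no ¬e = inj₂ (¬e , ⇒-intro (num-≐-elim _ _ ¬e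
  (≐-trans (≐-sym (eval f ρ)) (≐-trans hyp₀ (eval g ρ)))))

⊥ᵉ : Expressible {m} (λ ρ → ⊥)
formula ⊥ᵉ = ⊥̇
decide ⊥ᵉ ρ = inj₂ ((λ ()) , ⇒-intro hyp₀)

_∧ᵉ_ : Expressible R → Expressible S → Expressible (λ ρ → R ρ × S ρ)
formula (r ∧ᵉ s) = formula r ∧̇ formula s
decide (r ∧ᵉ s) ρ with decide r ρ | decide s ρ
... | inj₁ (x , p)  | inj₁ (y , q)  = inj₁ ((x , y) , ∧-intro p q)
... | inj₁ _        | inj₂ (¬y , q) = inj₂ ((λ (_ , y) → ¬y y) , ⇒-intro (⇒-elim q (∧-elimʳ hyp₀)))
... | inj₂ (¬x , p) | _             = inj₂ ((λ (x , _) → ¬x x) , ⇒-intro (⇒-elim p (∧-elimˡ hyp₀)))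

_⇒ᵉ_ : Expressible R → Expressible S → Expressible (λ ρ → R ρ → S ρ)
formula (r ⇒ᵉ s) = formula r ⇒ formula s
decide (r ⇒ᵉ s) ρ with decide r ρ | decide s ρ
... | inj₂ (¬x , p) | _             = inj₁ ((λ x → contradiction x ¬x) , ⇒-trans p ex-falso)
... | inj₁ _        | inj₁ (y , q)  = inj₁ ((λ _ → y) , ⇒-intro q)
... | inj₁ (x , p)  | inj₂ (¬y , q) = inj₂ ((λ f → ¬y (f x)) , ⇒-intro (⇒-elim q (⇒-elim hyp₀ p)))

search : ∀ {a b} {A : ℕ → Set a} {B : ℕ → Set b} → (∀ x → A x ⊎ B x) →
         ∀ b → (∃[ x ] x ≤ b × A x) ⊎ (∀ x → x ≤ b → B x)
search {B = B} d zero with d 0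
... | inj₁ a = inj₁ (0 , z≤n , a)
... | inj₂ b = inj₂ λ { .0 z≤n → b }
search {B = B} d (suc c) with search d c | d (suc c)
... | inj₁ (x , x≤c , a) | _      = inj₁ (x , m≤n⇒m≤1+n x≤c , a)
... | inj₂ _             | inj₁ a = inj₁ (suc c , ≤-refl , a)
... | inj₂ f             | inj₂ b = inj₂ below
  where
  below : ∀ x → x ≤ suc c → B x
  below x x≤1+c with m≤n⇒m<n∨m≡n x≤1+c
  ... | inj₁ (s≤s x≤c) = f x x≤c
  ... | inj₂ refl      = b

∷ₛ-resp-≐ : {σ : Fin m → Term n} (φ : Formula (suc m)) → Q ∣ Γ ⊢ t ≐ u →
            Q ∣ Γ ⊢ subst (t ∷ₛ σ) φ → Q ∣ Γ ⊢ subst (u ∷ₛ σ) φ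
∷ₛ-resp-≐ {t = t} {u} {σ} φ e d = cast (subst-liftₛ-inst u σ φ)
  (≐-subst (subst (liftₛ σ) φ) e (cast (sym (subst-liftₛ-inst t σ φ)) d))

liftₛ-nums : (ρ : Vec ℕ m) → liftₛ (nums {n = n} ρ) ≗ ` zero ∷ₛ nums ρ
liftₛ-nums ρ zero    = refl
liftₛ-nums ρ (suc i) = renameᵗ-num suc (lookup ρ i)

nums-∷ : ∀ x (ρ : Vec ℕ m) → nums {n = n} (x ∷ ρ) ≗ num x ∷ₛ nums ρ
nums-∷ x ρ zero    = refl
nums-∷ x ρ (suc i) = refl

inst-nums : ∀ x (ρ : Vec ℕ m) (φ : Formula (suc m)) →
            subst (liftₛ (nums {n = n} ρ)) φ [ num x ] ≡ subst (nums (x ∷ ρ)) φ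
inst-nums x ρ φ = trans (subst-liftₛ-inst (num x) (nums ρ) φ)
  (sym (subst-cong (nums-∷ x ρ) φ))

-- `≦num-elim` splits a bounded quantifier into cases in which the bound variable equals a numeral.
-- This lemma and `generalise` pass between such a case and the decision made at that numeral.
specialise : ∀ {x} {ρ : Vec ℕ m} (φ : Formula (suc m)) → Q ∣ Γ ⊢ ` zero ≐ num x →
             Q ∣ Γ ⊢ subst (liftₛ (nums ρ)) φ → Q ∣ Γ ⊢ subst (nums (x ∷ ρ)) φ
specialise {x = x} {ρ} φ e d = cast (sym (subst-cong (nums-∷ x ρ) φ))
  (∷ₛ-resp-≐ φ e (cast (subst-cong (liftₛ-nums ρ) φ) d))

generalise : ∀ {x} {ρ : Vec ℕ m} (φ : Formula (suc m)) → Q ∣ Γ ⊢ ` zero ≐ num x →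
             Q ∣ Γ ⊢ subst (nums (x ∷ ρ)) φ → Q ∣ Γ ⊢ subst (liftₛ (nums ρ)) φ
generalise {x = x} {ρ} φ e d = cast (sym (subst-cong (liftₛ-nums ρ) φ))
  (∷ₛ-resp-≐ φ (≐-sym e) (cast (subst-cong (nums-∷ x ρ) φ) d))

module _ {F : Vec ℕ m → ℕ} (f : TermFn F) where

  eval-liftₛ : ∀ ρ → Q ∣ Γ ⊢ substᵗ (liftₛ (nums ρ)) (↑ term f) ≐ num (F ρ)
  eval-liftₛ ρ = cast
    (cong (_≐ num (F ρ)) (sym (trans (substᵗ-cong (liftₛ-nums ρ) (↑ term f))
      (substᵗ-renameᵗ (` zero ∷ₛ nums ρ) suc (term f)))))
    (eval f ρ)

  num≦term : ∀ {x} ρ → x ≤ F ρ →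
             Q ∣ Γ ⊢ num x ≦ substᵗ (inst (num x)) (substᵗ (liftₛ (nums ρ)) (↑ term f))
  num≦term {x = x} ρ x≤ = ≦-resp (≐-refl _)
    (≐-sym (cast
      (cong (_≐ num (F ρ)) (sym (substᵗ-liftₛ-inst (num x) (nums ρ) (term f)))) (eval f ρ)))
    (num-≦ x≤)

  ∃≤ᵉ : Expressible R → Expressible (λ ρ → ∃[ x ] x ≤ F ρ × R (x ∷ ρ))
  formula (∃≤ᵉ r) = ∃̇ (` zero ≦ ↑ term f ∧̇ formula r)
  decide (∃≤ᵉ r) ρ with search (λ x → decide r (x ∷ ρ)) (F ρ)
  ... | inj₁ (x , x≤ , y , p) = inj₁ ((x , x≤ , y) , ∃-intro (num x)
        (∧-intro (num≦term ρ x≤) (cast (sym (inst-nums x ρ (formula r))) p)))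
  ... | inj₂ none = inj₂ ((λ (x , x≤ , y) → proj₁ (none x x≤) y) ,
        -- Provably in `Q`, a witness below the bound is one of finitely many numerals, and the
        -- formula is refuted at each of them.
        ⇒-intro (∃-elim hyp₀ (⇒-elim
          (≦num-elim (F ρ) λ a a≤ → ⇒-intro
            (⇒-elim (proj₂ (none a a≤)) (specialise (formula r) hyp₀ (∧-elimʳ hyp₁))))
          (≦-resp (≐-refl _) (eval-liftₛ ρ) (∧-elimˡ hyp₀)))))

  ∀≤ᵉ : Expressible R → Expressible (λ ρ → ∀ x → x ≤ F ρ → R (x ∷ ρ))
  formula (∀≤ᵉ r) = ∀̇ (` zero ≦ ↑ term f ⇒ formula r)
  decide (∀≤ᵉ r) ρ with search (λ x → swap (decide r (x ∷ ρ))) (F ρ)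
  ... | inj₁ (x , x≤ , ¬y , q) = inj₂ ((λ h → ¬y (h x x≤)) , ⇒-intro (⇒-elim q
        (cast (inst-nums x ρ (formula r)) (⇒-elim (∀-elim (num x) hyp₀) (num≦term ρ x≤)))))
  ... | inj₂ all = inj₁ ((λ x x≤ → proj₁ (all x x≤)) ,
        ∀-intro (⇒-intro (⇒-elim
          (≦num-elim (F ρ) λ a a≤ → ⇒-intro (generalise (formula r) hyp₀ (proj₂ (all a a≤))))
          (≦-resp (≐-refl _) (eval-liftₛ ρ) hyp₀))))

-- Under the inner quantifier of Rosser's formula the environment is `v ∷ w ∷ x ∷ []`, while the
-- second relation speaks of `v` and `x` only.
skip₁ : Fin (suc m) → Term (suc (suc m))
skip₁ = ` zero ∷ₛ λ i → ` suc (suc i)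

nums-skip₁ : ∀ v w (ρ : Vec ℕ m) (φ : Formula (suc m)) →
             subst (nums {n = n} (v ∷ w ∷ ρ)) (subst skip₁ φ) ≡ subst (nums (v ∷ ρ)) φ
nums-skip₁ v w ρ φ = trans (subst-subst _ skip₁ φ)
  (subst-cong (λ { zero → refl ; (suc i) → refl }) φ)

skip₁ᵉ : Expressible R → Expressible (λ ρ → R (head ρ ∷ tail (tail ρ)))
formula (skip₁ᵉ r) = subst skip₁ (formula r)
decide (skip₁ᵉ r) (v ∷ w ∷ ρ) with decide r (v ∷ ρ)
... | inj₁ (y , p)  = inj₁ (y , cast (sym (nums-skip₁ v w ρ (formula r))) p)
... | inj₂ (¬y , p) = inj₂ (¬y , cast (cong ¬̇_ (sym (nums-skip₁ v w ρ (formula r)))) p)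

-- Rosser's trick: the first witness of A comes before every witness of B.
module Rosser {A B : Vec ℕ 2 → Set} (a : Expressible A) (b : Expressible B) where

  earlier : Expressible (λ ρ → A ρ × (∀ v → v ≤ head ρ → B (v ∷ tail ρ) → ⊥))
  earlier = a ∧ᵉ ∀≤ᵉ headᶠ (skip₁ᵉ b ⇒ᵉ ⊥ᵉ)

  separator : Formula 1
  separator = ∃̇ formula earlier

  separator-provable : ∀ {w x} → A (w ∷ x ∷ []) → (∀ v → ¬ B (v ∷ x ∷ [])) →
                       Provable (x ∷ []) separator
  separator-provable {w} {x} y none = ∃-intro (num w)
    (cast (sym (inst-nums w (x ∷ []) (formula earlier)))
      (provable earlier (w ∷ x ∷ []) (y , λ v _ → none v)))

  -- A supposed witness is compared with the numeral of `w`. If it lies below, it is a numeral, and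
  -- `A` fails there. If it lies above, Rosser's clause denies `B` at `w`, where `Q` proves it.
  separator-refutable : ∀ {w x} → B (w ∷ x ∷ []) → (∀ v → ¬ A (v ∷ x ∷ [])) →
                        Refutable (x ∷ []) separator
  separator-refutable {w} {x} y none = ⇒-intro (∃-elim hyp₀ (∨-elim (≦num-total w (` zero))
    (⇒-elim
      (≦num-elim w λ v _ → ⇒-intro (⇒-elim
        (refutable earlier (v ∷ x ∷ []) (λ (z , _) → none v z))
        (specialise (formula earlier) hyp₀ hyp₂)))
      hyp₀)
    (⇒-elim (⇒-elim (∀-elim (num w) (∧-elimʳ hyp₁)) hyp₀)
      (cast (sym skip-witness) (provable b (w ∷ x ∷ []) y)))))
    where
    skip-witness : subst (liftₛ (liftₛ (nums (x ∷ [])))) (subst skip₁ (formula b)) [ num w ]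
                   ≡ subst (nums {n = suc n} (w ∷ x ∷ [])) (formula b)
    skip-witness = trans (subst-liftₛ-inst (num w) _ (subst skip₁ (formula b)))
      (trans (subst-subst _ skip₁ (formula b))
        (subst-cong (λ { zero → refl ; (suc zero) → renameᵗ-num suc x }) (formula b)))

-- Transfer of theorems from `Q` to its extensions

-- T ⊢ φ gives the axioms of Q only under no variables, where an eigenvariable
-- would require renaming a derivation of T. Turning the axioms into assumptions,
-- discharged at the end, avoids this.
Q-axioms : List Sentence
Q-axioms =
  ∀̇ (¬̇ (𝐬 (` zero) ≐ 𝟎)) ∷
  ∀̇ (∀̇ (𝐬 (` suc zero) ≐ 𝐬 (` zero) ⇒ ` suc zero ≐ ` zero)) ∷
  ∀̇ (¬̇ (` zero ≐ 𝟎) ⇒ ∃̇ (` suc zero ≐ 𝐬 (` zero))) ∷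
  ∀̇ (` zero ⊕ 𝟎 ≐ ` zero) ∷
  ∀̇ (∀̇ (` suc zero ⊕ 𝐬 (` zero) ≐ 𝐬 (` suc zero ⊕ ` zero))) ∷
  ∀̇ (` zero ⊗ 𝟎 ≐ 𝟎) ∷
  ∀̇ (∀̇ (` suc zero ⊗ 𝐬 (` zero) ≐ ` suc zero ⊗ ` zero ⊕ ` suc zero)) ∷
  ∀̇ (∀̇ (` suc zero ≦ ` zero ⇔ ∃̇ (` zero ⊕ ` suc (suc zero) ≐ ` suc zero))) ∷
  []

∈-Q-axioms : ∀ {φ} → Q φ → φ ∈ˡ Q-axioms
∈-Q-axioms 𝐬≠𝟎   = here refl
∈-Q-axioms 𝐬-inj = there (here refl)
∈-Q-axioms pred  = there (there (here refl))
∈-Q-axioms ⊕-𝟎   = there (there (there (here refl)))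
∈-Q-axioms ⊕-𝐬   = there (there (there (there (here refl))))
∈-Q-axioms ⊗-𝟎   = there (there (there (there (there (here refl)))))
∈-Q-axioms ⊗-𝐬   = there (there (there (there (there (there (here refl))))))
∈-Q-axioms ≦-def = there (there (there (there (there (there (there (here refl)))))))

All-Q-axioms : ∀ {p} {P : Sentence → Set p} → (∀ {φ} → Q φ → P φ) → All P Q-axioms
All-Q-axioms h = h 𝐬≠𝟎 ∷ h 𝐬-inj ∷ h pred ∷ h ⊕-𝟎 ∷ h ⊕-𝐬 ∷ h ⊗-𝟎 ∷ h ⊗-𝐬 ∷ h ≦-def ∷ []

module _ {ℓ} {T : Theory ℓ} where

  -- map-++ suffices because weaken fixes the eight closed axioms by computation.
  weaken-Q-axioms : (Γ : List (Formula n)) →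
                    map weaken (Γ ++ map closed Q-axioms) ≡ map weaken Γ ++ map closed Q-axioms
  weaken-Q-axioms Γ = map-++ weaken Γ (map closed Q-axioms)

  axioms-to-assumptions : {Γ : List (Formula n)} → Q ∣ Γ ⊢ φ → T ∣ Γ ++ map closed Q-axioms ⊢ φ
  axioms-to-assumptions {Γ = Γ} (axiom q) =
    assume (∈-++⁺ʳ Γ (∈-map⁺ closed (∈-Q-axioms q)))
  axioms-to-assumptions (assume i)     = assume (∈-++⁺ˡ i)
  axioms-to-assumptions (raa d)        = raa (axioms-to-assumptions d)
  axioms-to-assumptions (⇒-intro d)    = ⇒-intro (axioms-to-assumptions d)
  axioms-to-assumptions (⇒-elim d e)   = ⇒-elim (axioms-to-assumptions d) (axioms-to-assumptions e)
  axioms-to-assumptions (∧-intro d e)  = ∧-intro (axioms-to-assumptions d) (axioms-to-assumptions e)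
  axioms-to-assumptions (∧-elimˡ d)    = ∧-elimˡ (axioms-to-assumptions d)
  axioms-to-assumptions (∧-elimʳ d)    = ∧-elimʳ (axioms-to-assumptions d)
  axioms-to-assumptions (∨-introˡ d)   = ∨-introˡ (axioms-to-assumptions d)
  axioms-to-assumptions (∨-introʳ d)   = ∨-introʳ (axioms-to-assumptions d)
  axioms-to-assumptions (∨-elim d e f) = ∨-elim (axioms-to-assumptions d)
    (axioms-to-assumptions e) (axioms-to-assumptions f)
  axioms-to-assumptions {Γ = Γ} (∀-intro d) = ∀-intro
    (transport (T ∣_⊢ _) (sym (weaken-Q-axioms Γ)) (axioms-to-assumptions d))
  axioms-to-assumptions (∀-elim t d)   = ∀-elim t (axioms-to-assumptions d)
  axioms-to-assumptions (∃-intro t d)  = ∃-intro t (axioms-to-assumptions d)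
  axioms-to-assumptions {Γ = Γ} (∃-elim d e) = ∃-elim (axioms-to-assumptions d)
    (transport (λ Δ → T ∣ _ ∷ Δ ⊢ _) (sym (weaken-Q-axioms Γ)) (axioms-to-assumptions e))
  axioms-to-assumptions (≐-refl t)      = ≐-refl t
  axioms-to-assumptions (≐-subst φ d e) =
    ≐-subst φ (axioms-to-assumptions d) (axioms-to-assumptions e)

  discharge : {Γ : List (Formula n)} → All (T ∣ [] ⊢_) Γ → T ∣ Γ ⊢ φ → T ∣ [] ⊢ φ
  discharge []       e = e
  discharge (d ∷ ds) e = ⇒-elim (discharge ds (⇒-intro e)) d

  Q-theorems : T Extends Q → Q ⊢ φ → T ⊢ φ
  -- Without variables, `closed` fixes the eight axioms by computation, so derivations of the axioms
  -- serve for the assumptions.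
  Q-theorems ext d = discharge (All-Q-axioms ext) (axioms-to-assumptions d)

-- Diagonalization

-- Stating the argument by an equation keeps `ψ` intact. The code of the result is then obtained by
-- pairing from the codes of `ψ` and of a numeral, and substitution never has to be computed on
-- codes.
diag : Formula 1 → ℕ → Sentence
diag ψ a = ∀̇ (` zero ≐ num a ⇒ ψ)

-- Acts as the identity; diagonalizing ground ψ instead of ψ spares proving it.
ground : Formula 1 → Formula 1
ground = subst (liftₛ (nums []))

diag-provable : ∀ ψ {a} → Provable (a ∷ []) ψ → Q ⊢ diag (ground ψ) a
diag-provable ψ p = ∀-intro (⇒-intro (generalise ψ hyp₀ p))

diag-refutable : ∀ ψ {a} → Refutable (a ∷ []) ψ → Q ⊢ ¬̇ diag (ground ψ) a
diag-refutable ψ {a} p = ⇒-intro (⇒-elim p (cast (inst-nums a [] ψ)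
  (⇒-elim (∀-elim (num a) hyp₀)
    (cast (cong (num a ≐_) (sym (substᵗ-num (inst (num a)) a))) (≐-refl (num a))))))

-- Pairing and finite sets of pairs

-- Pairs with sum `s` take values between `s * s` and `s * s + s`, all below `suc s * suc s`.
pair-<-sum : ∀ {a b c d} → a + b < c + d → pair a b < pair c d
pair-<-sum {a} {b} {c} {d} lt = begin-strict
  (a + b) * (a + b) + a               ≤⟨ +-monoʳ-≤ ((a + b) * (a + b)) (m≤m+n a b) ⟩
  (a + b) * (a + b) + (a + b)         ≡⟨ +-comm ((a + b) * (a + b)) (a + b) ⟩
  suc (a + b) * (a + b)               <⟨ *-monoʳ-< (suc (a + b)) (n<1+n (a + b)) ⟩
  suc (a + b) * suc (a + b)           ≤⟨ *-mono-≤ lt lt ⟩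
  (c + d) * (c + d)                   ≤⟨ m≤m+n _ c ⟩
  (c + d) * (c + d) + c               ∎
  where open ≤-Reasoning

pair-injective : ∀ {a b c d} → pair a b ≡ pair c d → a ≡ c × b ≡ d
pair-injective {a} {b} {c} {d} e with <-cmp (a + b) (c + d)
... | tri< lt _ _ = contradiction e (<⇒≢ (pair-<-sum {a} {b} {c} {d} lt))
... | tri> _ _ gt = contradiction (sym e) (<⇒≢ (pair-<-sum {c} {d} {a} {b} gt))
... | tri≈ _ s _  = a≡c , +-cancelˡ-≡ a b d (trans s (cong (_+ d) (sym a≡c)))
  where
  a≡c : a ≡ c
  a≡c = +-cancelˡ-≡ ((a + b) * (a + b)) a c (trans e (cong (λ x → x * x + c) (sym s)))

pair-mono-≤ : ∀ {a b c d} → a ≤ c → b ≤ d → pair a b ≤ pair c d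
pair-mono-≤ a≤c b≤d = +-mono-≤ (*-mono-≤ (+-mono-≤ a≤c b≤d) (+-mono-≤ a≤c b≤d)) a≤c

-- As in Gödel's β function, the moduli 1 + (j + 1) b with j ≤ N are pairwise
-- coprime when b = N!. A set of numbers is coded by the product of its moduli
-- and recovered by divisibility, without the Chinese remainder theorem.

modulus : ℕ → ℕ → ℕ
modulus b j = suc (suc j * b)

-- Each modulus is 1 plus a multiple of `b`, so a common divisor `d` is coprime to `b`. It divides
-- the difference `b * suc e`, hence `suc e`, hence `b`, and therefore 1.
modulus-coprime : ∀ b i e → suc e ∣ⁿ b → Coprime (modulus b i) (modulus b (suc e + i))
modulus-coprime b i e e∣b {d} (d∣mᵢ , d∣mⱼ) = ∣1⇒≡1 (∣m+n∣m⇒∣n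
  (transport (d ∣ⁿ_) (+-comm 1 (suc i * b)) d∣mᵢ) (∣n⇒∣m*n (suc i) d∣b))
  where
  coprime-b : Coprime d b
  coprime-b {x} (x∣d , x∣b) = ∣1⇒≡1 (∣m+n∣m⇒∣n
    (transport (x ∣ⁿ_) (+-comm 1 (suc i * b)) (∣-trans x∣d d∣mᵢ)) (∣n⇒∣m*n (suc i) x∣b))

  difference : modulus b (suc e + i) ≡ modulus b i + b * suc e
  difference = cong suc (begin
    suc (suc e + i) * b         ≡⟨ cong (_* b) (+-comm (suc (suc e)) i) ⟩
    (i + suc (suc e)) * b       ≡⟨ cong (_* b) (+-suc i (suc e)) ⟩
    (suc i + suc e) * b         ≡⟨ *-distribʳ-+ b (suc i) (suc e) ⟩
    suc i * b + suc e * b       ≡⟨ cong (suc i * b +_) (*-comm (suc e) b) ⟩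
    suc i * b + b * suc e       ∎)
    where open ≡-Reasoning

  d∣b : d ∣ⁿ b
  d∣b = ∣-trans (coprime-divisor coprime-b
    (∣m+n∣m⇒∣n (transport (d ∣ⁿ_) difference d∣mⱼ) d∣mᵢ)) e∣b

suc∣! : ∀ {e N} → suc e ≤ N → suc e ∣ⁿ N !
suc∣! {e} e<N = ∣-trans (m∣m*n (e !)) (m≤n⇒m!∣n! e<N)

modulus-coprime-< : ∀ {N i j} → i < j → j ≤ N → Coprime (modulus (N !) i) (modulus (N !) j)
modulus-coprime-< {N} {i} {j} i<j j≤N with j ∸ suc i | m+[n∸m]≡n i<j
... | e | refl = transport (λ j → Coprime (modulus (N !) i) (modulus (N !) (suc j)))
  (+-comm e i) (modulus-coprime (N !) i e (suc∣! (≤-trans (s≤s (m≤n+m e i)) j≤N)))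

modulus-coprime-≢ : ∀ {N i j} → i ≤ N → j ≤ N → i ≢ j → Coprime (modulus (N !) i) (modulus (N !) j)
modulus-coprime-≢ {N} {i} {j} i≤N j≤N i≢j with <-cmp i j
... | tri≈ _ i≡j _ = contradiction i≡j i≢j
... | tri< i<j _ _ = modulus-coprime-< i<j j≤N
... | tri> _ _ j<i = coprime-sym (modulus-coprime-< j<i i≤N)

-- A modulus is coprime to every factor of another index, so such factors can be cancelled one by
-- one. If its own index never appears, it divides 1, which would force `N ! ≡ 0`.
modulus∣product⇒∈ : ∀ {N j} L → j ≤ N → All (_≤ N) L →
                    modulus (N !) j ∣ⁿ product (map (modulus (N !)) L) → j ∈ˡ L
modulus∣product⇒∈ {N} {j} [] j≤N [] d =
  contradiction (m+n≡0⇒m≡0 (N !) (suc-injective (∣1⇒≡1 d))) (≢-nonZero⁻¹ (N !) {{N !≢0}})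
modulus∣product⇒∈ {N} {j} (i ∷ L) j≤N (i≤N ∷ L≤N) d with j ≟ i
... | yes j≡i = here j≡i
... | no  j≢i = there (modulus∣product⇒∈ L j≤N L≤N
  (coprime-divisor (modulus-coprime-≢ j≤N i≤N j≢i) d))

-- Moduli are positive, so bounding the quotient by `a` loses nothing and turns divisibility into a
-- bounded statement.
Member : ℕ → ℕ → ℕ → ℕ → Set
Member a b i u = ∃[ q ] q ≤ a × q * modulus b (pair i u) ≡ a

Member⇒∣ : ∀ {a b i u} → Member a b i u → modulus b (pair i u) ∣ⁿ a
Member⇒∣ (q , _ , e) = divides q (sym e)

∣⇒Member : ∀ {a b i u} → modulus b (pair i u) ∣ⁿ a → Member a b i u
∣⇒Member {b = b} {i} {u} (divides q e) =
  q , transport (q ≤_) (sym e) (m≤m*n q (modulus b (pair i u))) , sym e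

-- Coprimality is available for indices up to `N = pair k c` only, so decoding is confined to the
-- box `i ≤ k`, `u ≤ c`.
set-code : ∀ (L : List (ℕ × ℕ)) k c → (∀ {i u} → (i , u) ∈ˡ L → i ≤ k × u ≤ c) →
           ∃[ a ] ∃[ b ] (∀ {i u} → (i , u) ∈ˡ L → Member a b i u) ×
                         (∀ {i u} → i ≤ k → u ≤ c → Member a b i u → (i , u) ∈ˡ L)
set-code L k c L≤ = product (map (modulus (N !)) codes) , N ! ,
    (λ {i} {u} x → ∣⇒Member {i = i} {u} (∈⇒∣product (∈-map⁺ (modulus (N !)) (∈-map⁺ code x)))) ,
    λ {i} {u} i≤k u≤c x → un-code
      (modulus∣product⇒∈ codes (pair-mono-≤ i≤k u≤c) codes≤N (Member⇒∣ {i = i} {u} x))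
  where
  N = pair k c
  code : ℕ × ℕ → ℕ
  code (i , u) = pair i u
  codes = map code L

  codes≤N : All (_≤ N) codes
  codes≤N = map⁺ (tabulate λ x → pair-mono-≤ (proj₁ (L≤ x)) (proj₂ (L≤ x)))

  un-code : ∀ {i u} → pair i u ∈ˡ codes → (i , u) ∈ˡ L
  un-code {i} {u} x with ∈-map⁻ code x
  ... | (j , v) , y , e with pair-injective {i} {u} {j} {v} e
  ... | refl , refl = y

-- Bounded graphs of recursive functions

-- Graph f w xs y: the value of f at xs is y, and w bounds all the numbers that
-- witness this. For prec the witnesses are a code (a , b) of a set of pairs
-- (i , u) closed under going one step down the recursion, and a bound c. It is
-- c, not w, that bounds the universal quantifiers: truth is then preserved when
-- w grows. The equation z + y ≡ c says that y ≤ c.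

Graph  : Rec n → ℕ → Vec ℕ n → ℕ → Set
-- The values of the inner functions are handed one by one to the continuation `K`: each takes a
-- bounded quantifier over numbers, and none ranges over vectors.
Graph* : Vec (Rec n) k → ℕ → Vec ℕ n → (Vec ℕ k → Set) → Set

Graph zero        w xs       y = y ≡ 0
Graph succ        w (x ∷ []) y = y ≡ suc x
Graph (proj i)    w xs       y = y ≡ lookup xs i
Graph (comp f gs) w xs       y = Graph* gs w xs λ ys → Graph f w ys y
Graph (prec f g)  w (k ∷ xs) y =
  ∃[ a ] a ≤ w × ∃[ b ] b ≤ w × ∃[ c ] c ≤ w ×
  (∃[ z ] z ≤ c × z + y ≡ c) × Member a b k y ×
  (∀ u → u ≤ c → Member a b 0 u → Graph f w xs u) ×
  (∀ i → i ≤ k → ∀ v → v ≤ c → Member a b (suc i) v →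
   ∃[ u ] u ≤ c × Member a b i u × Graph g w (i ∷ u ∷ xs) v)
Graph (μ f)       w xs       y =
  Graph f w (y ∷ xs) 0 ×
  -- The bounded quantifier is inclusive, so the last conjunct exempts `i = y` from having a nonzero
  -- value.
  (∀ i → i ≤ y → ∃[ z ] z ≤ w × Graph f w (i ∷ xs) z × (z ≡ 0 → i ≡ y))

Graph* []       w xs K = K []
Graph* (g ∷ gs) w xs K = ∃[ y ] y ≤ w × Graph g w xs y × Graph* gs w xs λ ys → K (y ∷ ys)

-- Soundness of the bounded graphs

Graph-sound  : ∀ (f : Rec n) {w xs y} → Graph f w xs y → f ⟨ xs ⟩↦ y
Graph*-sound : ∀ (gs : Vec (Rec n) k) {w xs K} → Graph* gs w xs K →
               ∃[ ys ] Pointwise (λ g y → g ⟨ xs ⟩↦ y) gs ys × K ys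

Graph-sound zero     refl = zero
Graph-sound succ     {xs = x ∷ []} refl = succ
Graph-sound (proj i) refl = proj i
Graph-sound (comp f gs) h with Graph*-sound gs h
... | ys , gs↦ys , h′ = comp gs↦ys (Graph-sound f h′)
Graph-sound (prec f g) {w} {k ∷ xs} {y}
            (a , _ , b , _ , c , _ , (z , _ , z+y≡c) , last , base , step) =
  descend k ≤-refl y (transport (y ≤_) z+y≡c (m≤n+m y z)) last
  where
  -- The coded set need not come from a computation: closure under descent already makes each of its
  -- pairs within the bounds correct.
  descend : ∀ i → i ≤ k → ∀ u → u ≤ c → Member a b i u → prec f g ⟨ i ∷ xs ⟩↦ u
  descend zero    _   u u≤c x = prec₀ (Graph-sound f (base u u≤c x))
  descend (suc i) i<k u u≤c x with step i (<⇒≤ i<k) u u≤c x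
  ... | v , v≤c , x′ , h = precₛ (descend i (<⇒≤ i<k) v v≤c x′) (Graph-sound g h)
Graph-sound (μ f) {w} {xs} {y} (h , below) = μ positive (Graph-sound f h)
  where
  positive : ∀ {i} → i < y → ∃[ z ] f ⟨ i ∷ xs ⟩↦ suc z
  positive {i} i<y with below i (<⇒≤ i<y)
  ... | zero  , _ , _  , z⇒ = contradiction (z⇒ refl) (<⇒≢ i<y)
  ... | suc z , _ , h′ , _  = z , Graph-sound f h′

Graph*-sound []       h = [] , [] , h
Graph*-sound (g ∷ gs) (y , _ , h , h′) with Graph*-sound gs h′
... | ys , gs↦ys , h″ = y ∷ ys , Graph-sound g h ∷ gs↦ys , h″

-- Completeness of the bounded graphs

-- Truth for all large `w`, unlike truth for some `w`, passes to finite conjunctions by taking the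
-- maximum of the thresholds.
Eventually : (ℕ → Set) → Set
Eventually P = ∃[ w₀ ] ∀ w → w₀ ≤ w → P w

private variable
  P P′ : ℕ → Set

eventually-map : (∀ w → P w → P′ w) → Eventually P → Eventually P′
eventually-map h (w₀ , p) = w₀ , λ w w≥ → h w (p w w≥)

eventually-× : Eventually P → Eventually P′ → Eventually (λ w → P w × P′ w)
eventually-× (w₀ , p) (w₁ , q) = w₀ ⊔ w₁ ,
  λ w w≥ → p w (≤-trans (m≤m⊔n w₀ w₁) w≥) , q w (≤-trans (m≤n⊔m w₀ w₁) w≥)

eventually-≥ : ∀ a → Eventually (a ≤_)
eventually-≥ a = a , λ w a≤w → a≤w

eventually-∀≤ : {S : ℕ → ℕ → Set} → ∀ y → (∀ i → i ≤ y → Eventually (S i)) →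
                Eventually (λ w → ∀ i → i ≤ y → S i w)
eventually-∀≤ zero    h = eventually-map (λ { w s .0 z≤n → s }) (h 0 z≤n)
eventually-∀≤ {S} (suc y) h = eventually-map extend
  (eventually-× (h (suc y) ≤-refl) (eventually-∀≤ y λ i i≤y → h i (m≤n⇒m≤1+n i≤y)))
  where
  extend : ∀ w → S (suc y) w × (∀ i → i ≤ y → S i w) → ∀ i → i ≤ suc y → S i w
  extend w (s , ss) i i≤1+y with m≤n⇒m<n∨m≡n i≤1+y
  ... | inj₁ (s≤s i≤y) = ss i i≤y
  ... | inj₂ refl      = s

Complete : Rec n → Set
Complete f = ∀ {xs y} → f ⟨ xs ⟩↦ y → Eventually λ w → Graph f w xs y

module _ {f : Rec n} {g : Rec (suc (suc n))}
         (f-complete : Complete f) (g-complete : Complete g) where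

  -- The stages remain an explicit list until the recursion is complete, because their code depends
  -- on bounds for the whole list.
  record Trace (xs : Vec ℕ n) (k y : ℕ) : Set where
    field
      pairs   : List (ℕ × ℕ)
      bound   : ℕ
      last    : (k , y) ∈ˡ pairs
      bounds  : ∀ {i u} → (i , u) ∈ˡ pairs → i ≤ k × u ≤ bound
      descent : Eventually λ w →
        (∀ {u} → (0 , u) ∈ˡ pairs → Graph f w xs u) ×
        (∀ {i v} → (suc i , v) ∈ˡ pairs → ∃[ u ] (i , u) ∈ˡ pairs × Graph g w (i ∷ u ∷ xs) v)

  open Trace

  trace : ∀ {k xs y} → prec f g ⟨ k ∷ xs ⟩↦ y → Trace xs k y
  trace {y = y} (prec₀ d) = record
    { pairs   = (0 , y) ∷ []
    ; bound   = y
    ; last    = here refl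
    ; bounds  = λ { (here refl) → z≤n , ≤-refl }
    ; descent = eventually-map
        (λ w h → (λ { (here refl) → h }) , λ { (here ()) ; (there ()) })
        (f-complete d)
    }
  trace {y = z} (precₛ {k = k} {y = y} d e) = let t = trace d in record
    { pairs   = (suc k , z) ∷ pairs t
    ; bound   = z ⊔ bound t
    ; last    = here refl
    ; bounds  = λ { (here refl) → ≤-refl , m≤m⊔n z (bound t)
                 ; (there x) → m≤n⇒m≤1+n (proj₁ (bounds t x)) ,
                               ≤-trans (proj₂ (bounds t x)) (m≤n⊔m z (bound t)) }
    ; descent = eventually-map
        (λ w (h , base , step) →
          (λ { (there x) → base x }) ,
          λ { (here refl) → y , there (last t) , h
            ; (there x) → let u , x′ , h′ = step x in u , there x′ , h′ })
        (eventually-× (g-complete e) (descent t))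
    }

  prec-complete : Complete (prec f g)
  prec-complete {k ∷ xs} {y} d with trace d
  -- The step condition in `Graph` includes `i = k` and so inspects pairs with first entry `suc k`.
  -- The box must reach one beyond the indices in the trace for these to be decoded.
  ... | t with set-code (pairs t) (suc k) (bound t)
                 (λ x → m≤n⇒m≤1+n (proj₁ (bounds t x)) , proj₂ (bounds t x))
  ... | a , b , to , from = eventually-map
    (λ w (a≤w , b≤w , c≤w , base , step) →
      a , a≤w , b , b≤w , bound t , c≤w ,
      (bound t ∸ y , m∸n≤m (bound t) y , m∸n+n≡m (proj₂ (bounds t (last t)))) ,
      to (last t) ,
      (λ u u≤c x → base (from z≤n u≤c x)) ,
      λ i i≤k v v≤c x → let u , x′ , h = step (from (s≤s i≤k) v≤c x)
                        in u , proj₂ (bounds t x′) , to x′ , h)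
    (eventually-× (eventually-≥ a) (eventually-× (eventually-≥ b)
      (eventually-× (eventually-≥ (bound t)) (descent t))))

Graph-complete  : (f : Rec n) → Complete f
Graph*-complete : ∀ (gs : Vec (Rec n) k) {xs ys} {K : ℕ → Vec ℕ k → Set} →
                  Pointwise (λ g y → g ⟨ xs ⟩↦ y) gs ys →
                  Eventually (λ w → K w ys) → Eventually (λ w → Graph* gs w xs (K w))

Graph-complete zero        zero       = 0 , λ _ _ → refl
Graph-complete succ        succ       = 0 , λ _ _ → refl
Graph-complete (proj i)    (proj .i)  = 0 , λ _ _ → refl
Graph-complete (comp f gs) {y = y} (comp ds d) =
  Graph*-complete gs {K = λ w ys → Graph f w ys y} ds (Graph-complete f d)
Graph-complete (prec f g)             = prec-complete (Graph-complete f) (Graph-complete g)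
Graph-complete (μ f) {xs} {y} (μ ds d) =
  eventually-× (Graph-complete f d) (eventually-∀≤ y search-step)
  where
  search-step : ∀ i → i ≤ y →
                Eventually λ w → ∃[ z ] z ≤ w × Graph f w (i ∷ xs) z × (z ≡ 0 → i ≡ y)
  search-step i i≤y with m≤n⇒m<n∨m≡n i≤y
  ... | inj₂ refl = eventually-map (λ w h → 0 , z≤n , h , λ _ → refl) (Graph-complete f d)
  ... | inj₁ i<y  = let z , d′ = ds i<y in eventually-map
    (λ w (z<w , h) → suc z , z<w , h , λ ())
    (eventually-× (eventually-≥ (suc z)) (Graph-complete f d′))

Graph*-complete []       []       h = h
Graph*-complete (g ∷ gs) {ys = y ∷ ys} {K} (d ∷ ds) h = eventually-map
  (λ w (y≤w , h′ , h″) → y , y≤w , h′ , h″)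
  (eventually-× (eventually-≥ y) (eventually-× (Graph-complete g d)
    (Graph*-complete gs {K = λ w ys → K w (y ∷ ys)} ds h)))

-- Expressibility of the bounded graphs

data TermFns {m} : ∀ {n} → (Vec ℕ m → Vec ℕ n) → Set where
  []  : TermFns λ ρ → []
  _∷_ : {F : Vec ℕ m → ℕ} {Fs : Vec ℕ m → Vec ℕ n} →
        TermFn F → TermFns Fs → TermFns λ ρ → F ρ ∷ Fs ρ

private variable
  Xs : Vec ℕ m → Vec ℕ n

lookupᶠ : TermFns Xs → ∀ i → TermFn λ ρ → lookup (Xs ρ) i
lookupᶠ (x ∷ xs) zero    = x
lookupᶠ (x ∷ xs) (suc i) = lookupᶠ xs i

Weakening : (Vec ℕ n → Vec ℕ m) → Set
Weakening π = ∀ {F} → TermFn F → TermFn (F ∘ π)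

weakenᶠ : {π : Vec ℕ n → Vec ℕ m} → Weakening π → TermFns Xs → TermFns (Xs ∘ π)
weakenᶠ wk []       = []
weakenᶠ wk (x ∷ xs) = wk x ∷ weakenᶠ wk xs

pairᶠ : TermFn F → TermFn H → TermFn λ ρ → pair (F ρ) (H ρ)
pairᶠ f h = (f +ᶠ h) *ᶠ (f +ᶠ h) +ᶠ f

memberᵉ : TermFn A → TermFn B → TermFn I → TermFn J →
          Expressible λ ρ → Member (A ρ) (B ρ) (I ρ) (J ρ)
memberᵉ a b i j = ∃≤ᵉ a
  (headᶠ *ᶠ sucᶠ (sucᶠ (pairᶠ (tailᶠ i) (tailᶠ j)) *ᶠ tailᶠ b) ≡ᵉ tailᶠ a)

Graphᵉ : (f : Rec n) → TermFn W → TermFns Xs → TermFn Y →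
         Expressible λ ρ → Graph f (W ρ) (Xs ρ) (Y ρ)
-- When the continuation's formula is finally built, the inner values have been bound as new
-- variables. Hence `κ` must work over any extended environment, and the weakening it receives
-- carries the outer terms there.
Graph*ᵉ : (gs : Vec (Rec n) k) → TermFn W → TermFns Xs → {K : Vec ℕ m → Vec ℕ k → Set} →
          (∀ {m′} {π : Vec ℕ m′ → Vec ℕ m} → Weakening π → {Ys : Vec ℕ m′ → Vec ℕ k} →
           TermFns Ys → Expressible λ ρ → K (π ρ) (Ys ρ)) →
          Expressible λ ρ → Graph* gs (W ρ) (Xs ρ) (K ρ)

Graphᵉ zero        w xs       y = y ≡ᵉ 0ᶠ
Graphᵉ succ        w (x ∷ []) y = y ≡ᵉ sucᶠ x
Graphᵉ (proj i)    w xs       y = y ≡ᵉ lookupᶠ xs i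
Graphᵉ (comp f gs) w xs       y = Graph*ᵉ gs w xs λ wk ys → Graphᵉ f (wk w) ys (wk y)
Graphᵉ (prec f g)  w (x ∷ xs) y =
  ∃≤ᵉ w (∃≤ᵉ (tailᶠ w) (∃≤ᵉ (tailᶠ (tailᶠ w)) (
    ∃≤ᵉ c (headᶠ +ᶠ tailᶠ (wk y) ≡ᵉ tailᶠ c) ∧ᵉ
    memberᵉ a b (wk x) (wk y) ∧ᵉ
    ∀≤ᵉ c (memberᵉ (tailᶠ a) (tailᶠ b) 0ᶠ headᶠ ⇒ᵉ
      Graphᵉ f (tailᶠ (wk w)) (weakenᶠ (tailᶠ ∘ wk) xs) headᶠ) ∧ᵉ
    ∀≤ᵉ (wk x) (∀≤ᵉ (tailᶠ c)
      (memberᵉ (tailᶠ (tailᶠ a)) (tailᶠ (tailᶠ b)) (sucᶠ (tailᶠ headᶠ)) headᶠ ⇒ᵉ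
       ∃≤ᵉ (tailᶠ (tailᶠ c))
         (memberᵉ (tailᶠ (tailᶠ (tailᶠ a))) (tailᶠ (tailᶠ (tailᶠ b))) (tailᶠ (tailᶠ headᶠ)) headᶠ ∧ᵉ
          Graphᵉ g (tailᶠ (tailᶠ (tailᶠ (wk w))))
            (tailᶠ (tailᶠ headᶠ) ∷ headᶠ ∷ weakenᶠ (tailᶠ ∘ tailᶠ ∘ tailᶠ ∘ wk) xs)
            (tailᶠ headᶠ)))))))
  where
  wk : Weakening (tail ∘ tail ∘ tail)
  wk t = tailᶠ (tailᶠ (tailᶠ t))
  a : TermFn (head ∘ tail ∘ tail)
  a = tailᶠ (tailᶠ headᶠ)
  b : TermFn (head ∘ tail)
  b = tailᶠ headᶠ
  c : TermFn head
  c = headᶠ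
Graphᵉ (μ f)       w xs       y =
  Graphᵉ f w (y ∷ xs) 0ᶠ ∧ᵉ
  ∀≤ᵉ y (∃≤ᵉ (tailᶠ w)
    (Graphᵉ f (tailᶠ (tailᶠ w)) (tailᶠ headᶠ ∷ weakenᶠ (tailᶠ ∘ tailᶠ) xs) headᶠ ∧ᵉ
     (headᶠ ≡ᵉ 0ᶠ ⇒ᵉ tailᶠ headᶠ ≡ᵉ tailᶠ (tailᶠ y))))

Graph*ᵉ []       w xs κ = κ id []
Graph*ᵉ (g ∷ gs) w xs {K} κ = ∃≤ᵉ w
  (Graphᵉ g (tailᶠ w) (weakenᶠ tailᶠ xs) headᶠ ∧ᵉ
   Graph*ᵉ gs (tailᶠ w) (weakenᶠ tailᶠ xs) {λ ρ ys → K (tail ρ) (head ρ ∷ ys)}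
     λ wk ys → κ (wk ∘ tailᶠ) (wk headᶠ ∷ ys))

-- Uniqueness of the values of recursive functions

↦-unique  : {f : Rec n} {xs : Vec ℕ n} {y z : ℕ} → f ⟨ xs ⟩↦ y → f ⟨ xs ⟩↦ z → y ≡ z
↦-unique* : {gs : Vec (Rec n) k} {xs : Vec ℕ n} {ys zs : Vec ℕ k} →
            Pointwise (λ g y → g ⟨ xs ⟩↦ y) gs ys →
            Pointwise (λ g z → g ⟨ xs ⟩↦ z) gs zs → ys ≡ zs

↦-unique zero      zero       = refl
↦-unique succ      succ       = refl
↦-unique (proj i)  (proj .i)  = refl
↦-unique (comp ds d) (comp es e) with ↦-unique* ds es
... | refl = ↦-unique d e
↦-unique (prec₀ d) (prec₀ e)  = ↦-unique d e
↦-unique (precₛ d d′) (precₛ e e′) with ↦-unique d e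
... | refl = ↦-unique d′ e′
↦-unique {y = y} {z} (μ ds d) (μ es e) with <-cmp y z
... | tri≈ _ y≡z _ = y≡z
... | tri< y<z _ _ = contradiction (↦-unique d (proj₂ (es y<z))) λ ()
... | tri> _ _ z<y = contradiction (↦-unique e (proj₂ (ds z<y))) λ ()

↦-unique* []       []       = refl
↦-unique* (d ∷ ds) (e ∷ es) = cong₂ _∷_ (↦-unique d e) (↦-unique* ds es)

-- Gödel numbers

-- Once tags are compared, only the diagonal cases of injectivity remain.

tagᵗ bodyᵗ : Term n → ℕ
tagᵗ (` i)   = 0
tagᵗ 𝟎       = 1
tagᵗ (𝐬 t)   = 2
tagᵗ (t ⊕ u) = 3
tagᵗ (t ⊗ u) = 4
bodyᵗ (` i)   = toℕ i
bodyᵗ 𝟎       = 0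
bodyᵗ (𝐬 t)   = ⌜ t ⌝ᵗ
bodyᵗ (t ⊕ u) = pair ⌜ t ⌝ᵗ ⌜ u ⌝ᵗ
bodyᵗ (t ⊗ u) = pair ⌜ t ⌝ᵗ ⌜ u ⌝ᵗ

⌜⌝ᵗ-pair : (t : Term n) → ⌜ t ⌝ᵗ ≡ pair (tagᵗ t) (bodyᵗ t)
⌜⌝ᵗ-pair (` i)   = refl
⌜⌝ᵗ-pair 𝟎       = refl
⌜⌝ᵗ-pair (𝐬 t)   = refl
⌜⌝ᵗ-pair (t ⊕ u) = refl
⌜⌝ᵗ-pair (t ⊗ u) = refl

⌜⌝ᵗ-injective : (t u : Term n) → ⌜ t ⌝ᵗ ≡ ⌜ u ⌝ᵗ → t ≡ u
same-tagᵗ : (t u : Term n) → tagᵗ t ≡ tagᵗ u → bodyᵗ t ≡ bodyᵗ u → t ≡ u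

⌜⌝ᵗ-injective t u e =
  let tag≡ , body≡ = pair-injective {tagᵗ t} {bodyᵗ t} {tagᵗ u} {bodyᵗ u}
                       (trans (sym (⌜⌝ᵗ-pair t)) (trans e (⌜⌝ᵗ-pair u)))
  in same-tagᵗ t u tag≡ body≡

same-tagᵗ (` i)   (` j)     refl e = cong `_ (toℕ-injective e)
same-tagᵗ 𝟎       𝟎         refl e = refl
same-tagᵗ (𝐬 t)   (𝐬 t′)    refl e = cong 𝐬 (⌜⌝ᵗ-injective t t′ e)
same-tagᵗ (t ⊕ u) (t′ ⊕ u′) refl e with pair-injective {⌜ t ⌝ᵗ} {⌜ u ⌝ᵗ} {⌜ t′ ⌝ᵗ} {⌜ u′ ⌝ᵗ} e
... | e₁ , e₂ = cong₂ _⊕_ (⌜⌝ᵗ-injective t t′ e₁) (⌜⌝ᵗ-injective u u′ e₂)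
same-tagᵗ (t ⊗ u) (t′ ⊗ u′) refl e with pair-injective {⌜ t ⌝ᵗ} {⌜ u ⌝ᵗ} {⌜ t′ ⌝ᵗ} {⌜ u′ ⌝ᵗ} e
... | e₁ , e₂ = cong₂ _⊗_ (⌜⌝ᵗ-injective t t′ e₁) (⌜⌝ᵗ-injective u u′ e₂)

tag body : Formula n → ℕ
tag ⊥̇        = 0
tag (t ≐ u)  = 1
tag (t ≦ u)  = 2
tag (φ ⇒ ψ)  = 3
tag (φ ∧̇ ψ)  = 4
tag (φ ∨̇ ψ)  = 5
tag (∀̇ φ)    = 6
tag (∃̇ φ)    = 7
body ⊥̇       = 0
body (t ≐ u) = pair ⌜ t ⌝ᵗ ⌜ u ⌝ᵗ
body (t ≦ u) = pair ⌜ t ⌝ᵗ ⌜ u ⌝ᵗ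
body (φ ⇒ ψ) = pair ⌜ φ ⌝ ⌜ ψ ⌝
body (φ ∧̇ ψ) = pair ⌜ φ ⌝ ⌜ ψ ⌝
body (φ ∨̇ ψ) = pair ⌜ φ ⌝ ⌜ ψ ⌝
body (∀̇ φ)   = ⌜ φ ⌝
body (∃̇ φ)   = ⌜ φ ⌝

⌜⌝-pair : (φ : Formula n) → ⌜ φ ⌝ ≡ pair (tag φ) (body φ)
⌜⌝-pair ⊥̇       = refl
⌜⌝-pair (t ≐ u) = refl
⌜⌝-pair (t ≦ u) = refl
⌜⌝-pair (φ ⇒ ψ) = refl
⌜⌝-pair (φ ∧̇ ψ) = refl
⌜⌝-pair (φ ∨̇ ψ) = refl
⌜⌝-pair (∀̇ φ)   = refl
⌜⌝-pair (∃̇ φ)   = refl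

⌜⌝-injective : (φ ψ : Formula n) → ⌜ φ ⌝ ≡ ⌜ ψ ⌝ → φ ≡ ψ
same-tag : (φ ψ : Formula n) → tag φ ≡ tag ψ → body φ ≡ body ψ → φ ≡ ψ

⌜⌝-injective φ ψ e =
  let tag≡ , body≡ = pair-injective {tag φ} {body φ} {tag ψ} {body ψ}
                       (trans (sym (⌜⌝-pair φ)) (trans e (⌜⌝-pair ψ)))
  in same-tag φ ψ tag≡ body≡

same-tag ⊥̇       ⊥̇         refl e = refl
same-tag (t ≐ u) (t′ ≐ u′) refl e with pair-injective {⌜ t ⌝ᵗ} {⌜ u ⌝ᵗ} {⌜ t′ ⌝ᵗ} {⌜ u′ ⌝ᵗ} e
... | e₁ , e₂ = cong₂ _≐_ (⌜⌝ᵗ-injective t t′ e₁) (⌜⌝ᵗ-injective u u′ e₂)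
same-tag (t ≦ u) (t′ ≦ u′) refl e with pair-injective {⌜ t ⌝ᵗ} {⌜ u ⌝ᵗ} {⌜ t′ ⌝ᵗ} {⌜ u′ ⌝ᵗ} e
... | e₁ , e₂ = cong₂ _≦_ (⌜⌝ᵗ-injective t t′ e₁) (⌜⌝ᵗ-injective u u′ e₂)
same-tag (φ ⇒ ψ) (φ′ ⇒ ψ′) refl e with pair-injective {⌜ φ ⌝} {⌜ ψ ⌝} {⌜ φ′ ⌝} {⌜ ψ′ ⌝} e
... | e₁ , e₂ = cong₂ _⇒_ (⌜⌝-injective φ φ′ e₁) (⌜⌝-injective ψ ψ′ e₂)
same-tag (φ ∧̇ ψ) (φ′ ∧̇ ψ′) refl e with pair-injective {⌜ φ ⌝} {⌜ ψ ⌝} {⌜ φ′ ⌝} {⌜ ψ′ ⌝} e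
... | e₁ , e₂ = cong₂ _∧̇_ (⌜⌝-injective φ φ′ e₁) (⌜⌝-injective ψ ψ′ e₂)
same-tag (φ ∨̇ ψ) (φ′ ∨̇ ψ′) refl e with pair-injective {⌜ φ ⌝} {⌜ ψ ⌝} {⌜ φ′ ⌝} {⌜ ψ′ ⌝} e
... | e₁ , e₂ = cong₂ _∨̇_ (⌜⌝-injective φ φ′ e₁) (⌜⌝-injective ψ ψ′ e₂)
same-tag (∀̇ φ)   (∀̇ φ′)    refl e = cong ∀̇_ (⌜⌝-injective φ φ′ e)
same-tag (∃̇ φ)   (∃̇ φ′)    refl e = cong ∃̇_ (⌜⌝-injective φ φ′ e)

-- Recursiveness of the diagonal function

RecFn : (Vec ℕ n → ℕ) → Set
RecFn F = ∃[ f ] ∀ xs → f ⟨ xs ⟩↦ F xs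

projʳ : (i : Fin n) → RecFn λ xs → lookup xs i
projʳ i = proj i , λ xs → proj i

sucʳ : RecFn F → RecFn λ xs → suc (F xs)
sucʳ (f , d) = comp succ (f ∷ []) , λ xs → comp (d xs ∷ []) succ

constʳ : ∀ a → RecFn {n} λ xs → a
constʳ zero    = zero , λ xs → zero
constʳ (suc a) = sucʳ (constʳ a)

comp₂ʳ : {op : ℕ → ℕ → ℕ} → (∃[ f ] ∀ x y → f ⟨ x ∷ y ∷ [] ⟩↦ op x y) →
         RecFn F → RecFn H → RecFn λ xs → op (F xs) (H xs)
comp₂ʳ (f , d) (g , e) (h , e′) = comp f (g ∷ h ∷ []) , λ xs → comp (e xs ∷ e′ xs ∷ []) (d _ _)

addition : ∃[ f ] ∀ x y → f ⟨ x ∷ y ∷ [] ⟩↦ x + y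
addition = f , compute
  where
  f = prec (proj zero) (comp succ (proj (suc zero) ∷ []))
  compute : ∀ x y → f ⟨ x ∷ y ∷ [] ⟩↦ x + y
  compute zero    y = prec₀ (proj zero)
  compute (suc x) y = precₛ (compute x y) (comp (proj (suc zero) ∷ []) succ)

_+ʳ_ : RecFn F → RecFn H → RecFn λ xs → F xs + H xs
_+ʳ_ = comp₂ʳ addition

multiplication : ∃[ f ] ∀ x y → f ⟨ x ∷ y ∷ [] ⟩↦ x * y
multiplication = f , compute
  where
  step = projʳ {3} (suc (suc zero)) +ʳ projʳ (suc zero)
  f = prec zero (proj₁ step)
  compute : ∀ x y → f ⟨ x ∷ y ∷ [] ⟩↦ x * y
  compute zero    y = prec₀ zero
  compute (suc x) y = precₛ (compute x y) (proj₂ step (x ∷ x * y ∷ y ∷ []))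

_*ʳ_ : RecFn F → RecFn H → RecFn λ xs → F xs * H xs
_*ʳ_ = comp₂ʳ multiplication

pairʳ : RecFn F → RecFn H → RecFn λ xs → pair (F xs) (H xs)
pairʳ f h = ((f +ʳ h) *ʳ (f +ʳ h)) +ʳ f

⌜num⌝ʳ : RecFn λ xs → ⌜ num {n} (head xs) ⌝ᵗ
⌜num⌝ʳ {n} = f , λ { (x ∷ []) → compute x }
  where
  base = constʳ {0} (pair 1 0)
  step = pairʳ (constʳ {2} 2) (projʳ (suc zero))
  f = prec (proj₁ base) (proj₁ step)
  compute : ∀ x → f ⟨ x ∷ [] ⟩↦ ⌜ num {n} x ⌝ᵗ
  compute zero    = prec₀ (proj₂ base [])
  compute (suc x) = precₛ (compute x) (proj₂ step (x ∷ ⌜ num {n} x ⌝ᵗ ∷ []))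

-- Opaque because unfolding pair at these literals is intractable.
opaque
  ⌜diag⌝ʳ : ∃[ f ] ∀ ψ → f ⟨ ⌜ ψ ⌝ ∷ [] ⟩↦ ⌜ diag ψ ⌜ ψ ⌝ ⌝
  ⌜diag⌝ʳ =
    let f , d = pairʳ (constʳ 6) (pairʳ (constʳ 3) (pairʳ
                  (pairʳ (constʳ 1) (pairʳ (constʳ (pair 0 0)) (⌜num⌝ʳ {1}))) (projʳ zero)))
    in f , λ ψ → d (⌜ ψ ⌝ ∷ [])

-- Separation of values and the diagonal sentence

-- The function `g` may be partial. Where it has one of the two values, soundness of the graphs and
-- uniqueness of values rule out every witness for the other.
separation : (g : Rec 1) → ∃[ ψ ] ∀ x → (g ⟨ x ∷ [] ⟩↦ 0 → Provable (x ∷ []) ψ) ×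
                                      (g ⟨ x ∷ [] ⟩↦ 1 → Refutable (x ∷ []) ψ)
separation g = separator , λ x →
  (λ value → let w , h = Graph-complete g value in
    separator-provable (h w ≤-refl) (no-other value λ ())) ,
  (λ value → let w , h = Graph-complete g value in
    separator-refutable (h w ≤-refl) (no-other value λ ()))
  where
  graphᵉ : {Y : Vec ℕ 2 → ℕ} → TermFn Y →
           Expressible λ ρ → Graph g (head ρ) (head (tail ρ) ∷ []) (Y ρ)
  graphᵉ = Graphᵉ g headᶠ (tailᶠ headᶠ ∷ [])

  no-other : ∀ {x y z} → g ⟨ x ∷ [] ⟩↦ y → y ≢ z → ∀ v → ¬ Graph g v (x ∷ []) z
  no-other value y≢z v h = y≢z (↦-unique value (Graph-sound g h))

  open Rosser (graphᵉ 0ᶠ) (graphᵉ (sucᶠ 0ᶠ))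

opaque
  fixed-point : (f : Rec 1) → ∃[ θ ]
                (f ⟨ ⌜ θ ⌝ ∷ [] ⟩↦ 0 → Q ⊢ θ) × (f ⟨ ⌜ θ ⌝ ∷ [] ⟩↦ 1 → Q ⊢ ¬̇ θ)
  fixed-point f with ⌜diag⌝ʳ
  ... | δ , δ↦ with separation (comp f (δ ∷ []))
  ... | ψ , separates = diag (ground ψ) ⌜ ground ψ ⌝ ,
    (λ value → diag-provable ψ (proj₁ (separates _) (comp (δ↦ (ground ψ) ∷ []) value))) ,
    (λ value → diag-refutable ψ (proj₂ (separates _) (comp (δ↦ (ground ψ) ∷ []) value)))

corollary4 : ∀ {ℓ} (T : Theory ℓ) → T Extends Q → Consistent T → Undecidable T
corollary4 T ext con (f , char) with fixed-point f
... | θ , θ-provable , θ-refutable =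
  not-theorem (θ , Q-theorems ext (θ-provable (proj₂ (char ⌜ θ ⌝) not-theorem)) , refl)
  where
  -- This uses only the positive clause of `char`, and its conclusion is the hypothesis of the
  -- negative one, so no case distinction on `T ⊢ θ` is made.
  not-theorem : ¬ TheoremNumbers T ⌜ θ ⌝
  not-theorem t@(φ , T⊢φ , e) = con (⇒-elim
    (Q-theorems ext (θ-refutable (proj₁ (char ⌜ θ ⌝) t)))
    -- A theorem number yields only some theorem with the code of `θ`; injectivity of the coding
    -- identifies it with `θ`.
    (transport (T ⊢_) (⌜⌝-injective φ θ e) T⊢φ))
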